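{- Let $p$ be a prime, $d\ge 2$ an integer, $F$ an ordered basis of $\mathbb F_p^{\mathbb N}$, and $k\in\mathbb N$. Let $w(a)=w_{F,d}(a)$ $(a\in\mathbb N)$ be the lexicographic words, $\mathrm{Lex}_{F,d}(k)=\{w(0),w(1),\dots,w(p^k-1)\}$ the lexicographic code, and $w^+(a)=\sum_{i\in\mathbb N}a_i\,w(p^i)$, where $a=\sum_i a_ip^i$ with $a_i\in\{0,\dots,p-1\}$ is the $p$-ary expansion of $a$. Then the following three conditions are equivalent. (1) $\mathrm{Lex}_{F,d}(k)$ is a linear code (i.e. an $\mathbb F_p$-linear subspace of $\mathbb F_p^{\mathbb N}$). (2) $w(a)=w^+(a)$ for all $0\le a<p^k$. (3) $w(a)=w^+(a)$ for all $0\le a<p^k$ with $\sum_{i\in\mathbb N}a_i\le p-1$ (the sum taken in the integers).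
   Context: $\mathbb N$ is the set of non-negative integers. $\mathbb F_p$ is identified with $\{0,1,\dots,p-1\}$, and its elements are compared as integers. $\mathbb F_p^{\mathbb N}$ denotes the $\mathbb F_p$-vector space of sequences $(x_i)_{i\in\mathbb N}$ with $x_i\in\mathbb F_p$ and $x_i=0$ for all but finitely many $i$. For an ordered basis $F=(f_i)_{i\in\mathbb N}$ of $\mathbb F_p^{\mathbb N}$ write $x=\sum_i x_{[i]}f_i$. The total order $<_F$ on $\mathbb F_p^{\mathbb N}$ is: for $x\ne y$, let $N$ be the largest index with $x_{[N]}\neq y_{[N]}$; then $x<_F y$ iff $x_{[N]}<y_{[N]}$. The Hamming distance is $d(x,y)=|\{i\in\mathbb N: x_i\ne y_i\}|$ (with respect to the standard coordinates). The words $w(a)=w_{F,d}(a)$ are defined recursively: $w(a)$ is the minimum, with respect to $<_F$, of all $z\in\mathbb F_p^{\mathbb N}$ such that $d(z,w(b))\ge d$ for all $0\le b<a$. -}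

module Defs where

open import Data.Nat.Base
  using (ℕ; zero; suc; 2+; _+_; _*_; _^_; _⊔_; _/_; _≤_; _<_; z≤n; NonZero; NonTrivial;
         nonTrivial⇒nonZero; nonTrivial⇒n>1)
open import Data.Nat.DivMod using (_mod_; 0/n≡0; m/n<m)
open import Data.Nat.ListAction using (sum)
open import Data.Nat.Properties
  using (<-≤-trans; ≤-pred; *-zeroʳ; m⊔n≤o⇒m≤o; m⊔n≤o⇒n≤o)
open import Data.Fin.Base as Fin using (Fin; toℕ)
import Data.Fin.Properties as Fin
open import Data.List.Base using (length; filter; map; upTo)
open import Data.Product.Base using (∃-syntax; _×_; proj₁)
open import Data.Sum.Base using (_⊎_)
open import Level using (0ℓ)
open import Relation.Binary.PropositionalEquality using (_≡_; refl; trans; cong; cong₂)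
open import Relation.Nullary.Decidable using (¬?)
open import Relation.Unary using (Pred; _∈_)

-- 𝔽_p is Fin p with arithmetic modulo p; its elements are compared as integers
-- by Fin._<_.  Primality of p plays no role in the definitions, only p ≥ 2.
module _ {p : ℕ} .{{_ : NonTrivial p}} where

  private instance
    p≢0 : NonZero p
    p≢0 = nonTrivial⇒nonZero p

  infixl 6 _+ᶠ_
  infixl 7 _*ᶠ_

  0ᶠ : Fin p
  0ᶠ = 0 mod p

  _+ᶠ_ _*ᶠ_ : Fin p → Fin p → Fin p
  a +ᶠ b = (toℕ a + toℕ b) mod p
  a *ᶠ b = (toℕ a * toℕ b) mod p

  digit : ℕ → ℕ → Fin p
  digit a zero    = a mod p
  digit a (suc i) = digit (a / p) i

private
  0+0≡0 : ∀ {p} .{{_ : NonTrivial p}} → 0ᶠ +ᶠ 0ᶠ ≡ 0ᶠ {p}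
  0+0≡0 {2+ _} = refl

  c*0≡0 : ∀ {p} .{{_ : NonTrivial p}} (c : Fin p) → c *ᶠ 0ᶠ ≡ 0ᶠ
  c*0≡0 {p@(2+ _)} c = cong (_mod p) (*-zeroʳ (toℕ c))

  digit-vanish : ∀ {p} .{{_ : NonTrivial p}} a i → a ≤ i → digit {p} a i ≡ 0ᶠ
  digit-vanish {2+ _} zero zero    _ = refl
  digit-vanish {p@(2+ _)} zero (suc i) _ =
    trans (cong (λ a → digit a i) (0/n≡0 p)) (digit-vanish 0 i z≤n)
  digit-vanish {p@(2+ _)} a@(suc _) (suc i) a≤i =
    digit-vanish (a / p) i (≤-pred (<-≤-trans (m/n<m a p (nonTrivial⇒n>1 p)) a≤i))

-- Elements of 𝔽_p^ℕ.  The bound need not be sharp and the functions are compared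
-- pointwise, so equality in 𝔽_p^ℕ is _≈_, not _≡_.
record FinSeq (p : ℕ) .{{_ : NonTrivial p}} : Set where
  field
    at     : ℕ → Fin p
    bound  : ℕ
    vanish : ∀ i → bound ≤ i → at i ≡ 0ᶠ

open FinSeq public

module _ {p : ℕ} .{{_ : NonTrivial p}} where

  infix  4 _≈_
  infixl 6 _⊕_
  infixl 7 _⊙_

  _≈_ : FinSeq p → FinSeq p → Set
  x ≈ y = ∀ i → at x i ≡ at y i

  0ˢ : FinSeq p
  0ˢ = record { at = λ _ → 0ᶠ ; bound = 0 ; vanish = λ _ _ → refl }

  _⊕_ : FinSeq p → FinSeq p → FinSeq p
  x ⊕ y = record
    { at     = λ i → at x i +ᶠ at y i
    ; bound  = bound x ⊔ bound y
    ; vanish = λ i b≤i → trans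
        (cong₂ _+ᶠ_ (vanish x i (m⊔n≤o⇒m≤o (bound x) (bound y) b≤i))
                    (vanish y i (m⊔n≤o⇒n≤o (bound x) (bound y) b≤i)))
        0+0≡0
    }

  _⊙_ : Fin p → FinSeq p → FinSeq p
  c ⊙ x = record
    { at     = λ i → c *ᶠ at x i
    ; bound  = bound x
    ; vanish = λ i b≤i → trans (cong (c *ᶠ_) (vanish x i b≤i)) (c*0≡0 c)
    }

  sumˢ : ℕ → (ℕ → FinSeq p) → FinSeq p
  sumˢ zero    g = 0ˢ
  sumˢ (suc n) g = sumˢ n g ⊕ g n

  -- Σ_{i∈ℕ} cᵢ gᵢ; the terms beyond the bound of c vanish.
  lin : FinSeq p → (ℕ → FinSeq p) → FinSeq p
  lin c g = sumˢ (bound c) (λ i → at c i ⊙ g i)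

  -- The Hamming distance: x and y agree (both are 0) from the larger bound on.
  dist : FinSeq p → FinSeq p → ℕ
  dist x y = length (filter (λ i → ¬? (at x i Fin.≟ at y i)) (upTo (bound x ⊔ bound y)))

  record IsSubspace (C : Pred (FinSeq p) 0ℓ) : Set where
    field
      0∈        : 0ˢ ∈ C
      ⊕-closed : ∀ {x y} → x ∈ C → y ∈ C → x ⊕ y ∈ C
      ⊙-closed : ∀ c {x} → x ∈ C → c ⊙ x ∈ C

record OrderedBasis (p : ℕ) .{{_ : NonTrivial p}} : Set where
  field
    vec         : ℕ → FinSeq p
    spanning    : ∀ x → ∃[ c ] x ≈ lin c vec
    independent : ∀ c → lin c vec ≈ 0ˢ → c ≈ 0ˢ

  -- coord x i is x_[i].
  coord : FinSeq p → ℕ → Fin p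
  coord x = at (proj₁ (spanning x))

module _ {p : ℕ} .{{_ : NonTrivial p}} (F : OrderedBasis p) where
  open OrderedBasis F

  -- N is the largest index at which the coordinates differ.
  Less : FinSeq p → FinSeq p → Set
  Less x y = ∃[ N ] (coord x N Fin.< coord y N) × (∀ i → N < i → coord x i ≡ coord y i)

  IsMinimum : Pred (FinSeq p) 0ℓ → FinSeq p → Set
  IsMinimum S m = m ∈ S × (∀ z → z ∈ S → m ≈ z ⊎ Less m z)

  -- The recursion defining w_{F,d}; it determines w up to _≈_.
  IsLexWords : (d : ℕ) → (ℕ → FinSeq p) → Set
  IsLexWords d w = ∀ a → IsMinimum (λ z → ∀ b → b < a → d ≤ dist z (w b)) (w a)

module _ {p : ℕ} .{{_ : NonTrivial p}} where

  -- The p-ary expansion of a, as an element of 𝔽_p^ℕ; aᵢ = 0 for i ≥ a since a < pᵃ.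
  digits : ℕ → FinSeq p
  digits a = record { at = digit a ; bound = a ; vanish = digit-vanish a }

  digitSum : ℕ → ℕ
  digitSum a = sum (map (λ i → toℕ (at (digits a) i)) (upTo (bound (digits a))))

  Lex : (ℕ → FinSeq p) → ℕ → Pred (FinSeq p) 0ℓ
  Lex w k x = ∃[ a ] a < p ^ k × x ≈ w a

  _⁺ : (ℕ → FinSeq p) → ℕ → FinSeq p
  (w ⁺) a = lin (digits a) (λ i → w (p ^ i))

{-# OPTIONS --safe #-}

-- Let φ(e) = Σ eᵢ w(pⁱ) for digit vectors e; as φ is linear, (2) ⇒ (1).  Both implications to (2)
-- go by strong induction: if w(b) = w⁺(b) for all b < a, then φ separates e = digits a from all
-- smaller digit vectors by distance at least d, so w(a) ≤ w⁺(a) by minimality, and only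
-- w(a) < w⁺(a) has to be excluded.
--
-- (3) ⇒ (2).  Suppose z = w(a) < w⁺(a) = φ(e) and let M be the largest coordinate at which they
-- differ.  For f ≠ e digitwise below e, the word z - φ(e - f) is admissible at the index of f,
-- so φ(f) < z - φ(e - f); this forces φ(f)_[M] ≠ φ(e)_[M].  But if the digit sum of a is at least
-- p, then by the pigeonhole principle on partial sums some nonempty multiset of units of e
-- contributes 0 at M, and f := e without these units gives a contradiction.
--
-- (1) ⇒ (2).  Let j be the top digit position of a.  No φ(h) with top position j is smaller than
-- v = w(pʲ).  Hence v has leading coefficient 1, at N say, all words of index below pʲ vanish from
-- N on, and v vanishes wherever such a word has its leading coefficient.  So if z = w(a) < w⁺(a),
-- then z - z_[N] v is a word of index below pʲ, and z = w⁺(b) for some b < a, absurd.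

module Submission where

open import Defs
open import Algebra.Bundles using (CommutativeRing)
open import Data.Empty using (⊥; ⊥-elim)
open import Data.Fin.Base as Fin using (Fin; toℕ)
import Data.Fin.Properties as Fin
open import Data.List.Base using ([]; _∷_; [_]; _++_; length; filter; upTo; applyUpTo)
open import Data.List.Properties using (filter-++; filter-reject; ++-identityʳ; upTo-∷ʳ; map-upTo)
open import Data.Nat.Base
open import Data.Nat.Coprimality using (prime⇒coprime; coprime-Bézout)
open import Data.Nat.DivMod
open import Data.Nat.Divisibility using (divides-refl)
open import Data.Nat.GCD using (module Bézout)
open import Data.Nat.Induction using (<-rec)
open import Data.Nat.ListAction using (sum)
open import Data.Nat.Primality using (Prime)
open import Data.Nat.Properties
open import Data.Product.Base using (∃-syntax; _×_; _,_; proj₁; proj₂)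
open import Data.Sum.Base using (_⊎_; inj₁; inj₂; [_,_]′)
open import Function.Base using (_∘_; case_of_; id)
open import Function.Bundles using (_⇔_; mk⇔)
open import Level using (0ℓ)
open import Relation.Binary.Definitions using (tri<; tri≈; tri>)
open import Relation.Binary.PropositionalEquality hiding ([_])
open import Relation.Nullary using (¬_; yes; no; contradiction)
open import Relation.Nullary.Decidable using (¬?; decidable-stable)
open import Relation.Unary using (Pred; Decidable; _∈_)

module _ {p : ℕ} .{{_ : NonTrivial p}} where

  private instance
    p≢0 : NonZero p
    p≢0 = nonTrivial⇒nonZero p

  -- Arithmetic of the field 𝔽_p.

  ι : ℕ → Fin p
  ι n = n mod p

  toℕ-ι : ∀ n → toℕ (ι n) ≡ n % p
  toℕ-ι n = Fin.toℕ-fromℕ< (m%n<n n p)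

  toℕ-ι-< : ∀ {n} → n < p → toℕ (ι n) ≡ n
  toℕ-ι-< n<p = trans (toℕ-ι _) (m<n⇒m%n≡m n<p)

  ι-cong-% : ∀ {m n} → m % p ≡ n % p → ι m ≡ ι n
  ι-cong-% {m} {n} eq = Fin.toℕ-injective (trans (toℕ-ι m) (trans eq (sym (toℕ-ι n))))

  ι-toℕ : ∀ x → ι (toℕ x) ≡ x
  ι-toℕ x = Fin.toℕ-injective (toℕ-ι-< (Fin.toℕ<n x))

  -- Together with `ι-*` and `ι-toℕ` this carries associativity and distributivity over from ℕ:
  -- elements are written as `ι (toℕ x)`, and the law is applied under a single `ι`.
  ι-+ : ∀ m n → ι m +ᶠ ι n ≡ ι (m + n)
  ι-+ m n = ι-cong-% (trans (cong (_% p) (cong₂ _+_ (toℕ-ι m) (toℕ-ι n))) (sym (%-distribˡ-+ m n p)))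

  ι-* : ∀ m n → ι m *ᶠ ι n ≡ ι (m * n)
  ι-* m n = ι-cong-% (trans (cong (_% p) (cong₂ _*_ (toℕ-ι m) (toℕ-ι n))) (sym (%-distribˡ-* m n p)))

  ι-p : ∀ k → ι (k * p) ≡ 0ᶠ
  ι-p k = ι-cong-% (trans (m*n%n≡0 k p) (sym (m*n%n≡0 0 p)))

  toℕ-0ᶠ : toℕ (0ᶠ {p}) ≡ 0
  toℕ-0ᶠ = toℕ-ι-< (<-trans z<s (nonTrivial⇒n>1 p))

  1ᶠ : Fin p
  1ᶠ = ι 1

  toℕ-1ᶠ : toℕ 1ᶠ ≡ 1
  toℕ-1ᶠ = toℕ-ι-< (nonTrivial⇒n>1 p)

  infix 8 -ᶠ_

  -ᶠ_ : Fin p → Fin p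
  -ᶠ x = ι (p ∸ toℕ x)

  +ᶠ-comm : ∀ x y → x +ᶠ y ≡ y +ᶠ x
  +ᶠ-comm x y = cong ι (+-comm (toℕ x) (toℕ y))

  *ᶠ-comm : ∀ x y → x *ᶠ y ≡ y *ᶠ x
  *ᶠ-comm x y = cong ι (*-comm (toℕ x) (toℕ y))

  +ᶠ-assoc : ∀ x y z → (x +ᶠ y) +ᶠ z ≡ x +ᶠ (y +ᶠ z)
  +ᶠ-assoc x y z = begin
    x +ᶠ y +ᶠ z                          ≡⟨ cong (x +ᶠ y +ᶠ_) (ι-toℕ z) ⟨
    ι (toℕ x + toℕ y) +ᶠ ι (toℕ z)       ≡⟨ ι-+ _ _ ⟩
    ι (toℕ x + toℕ y + toℕ z)            ≡⟨ cong ι (+-assoc (toℕ x) (toℕ y) (toℕ z)) ⟩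
    ι (toℕ x + (toℕ y + toℕ z))          ≡⟨ ι-+ _ _ ⟨
    ι (toℕ x) +ᶠ (y +ᶠ z)                ≡⟨ cong (_+ᶠ (y +ᶠ z)) (ι-toℕ x) ⟩
    x +ᶠ (y +ᶠ z)                        ∎
    where open ≡-Reasoning

  *ᶠ-assoc : ∀ x y z → (x *ᶠ y) *ᶠ z ≡ x *ᶠ (y *ᶠ z)
  *ᶠ-assoc x y z = begin
    x *ᶠ y *ᶠ z                          ≡⟨ cong (x *ᶠ y *ᶠ_) (ι-toℕ z) ⟨
    ι (toℕ x * toℕ y) *ᶠ ι (toℕ z)       ≡⟨ ι-* _ _ ⟩
    ι (toℕ x * toℕ y * toℕ z)            ≡⟨ cong ι (*-assoc (toℕ x) (toℕ y) (toℕ z)) ⟩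
    ι (toℕ x * (toℕ y * toℕ z))          ≡⟨ ι-* _ _ ⟨
    ι (toℕ x) *ᶠ (y *ᶠ z)                ≡⟨ cong (_*ᶠ (y *ᶠ z)) (ι-toℕ x) ⟩
    x *ᶠ (y *ᶠ z)                        ∎
    where open ≡-Reasoning

  *ᶠ-distribˡ-+ᶠ : ∀ x y z → x *ᶠ (y +ᶠ z) ≡ x *ᶠ y +ᶠ x *ᶠ z
  *ᶠ-distribˡ-+ᶠ x y z = begin
    x *ᶠ (y +ᶠ z)                        ≡⟨ cong (_*ᶠ (y +ᶠ z)) (ι-toℕ x) ⟨
    ι (toℕ x) *ᶠ ι (toℕ y + toℕ z)       ≡⟨ ι-* _ _ ⟩
    ι (toℕ x * (toℕ y + toℕ z))          ≡⟨ cong ι (*-distribˡ-+ (toℕ x) (toℕ y) (toℕ z)) ⟩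
    ι (toℕ x * toℕ y + toℕ x * toℕ z)    ≡⟨ ι-+ _ _ ⟨
    x *ᶠ y +ᶠ x *ᶠ z                     ∎
    where open ≡-Reasoning

  +ᶠ-identityˡ : ∀ x → 0ᶠ +ᶠ x ≡ x
  +ᶠ-identityˡ x = trans (cong (λ n → ι (n + toℕ x)) toℕ-0ᶠ) (ι-toℕ x)

  *ᶠ-identityˡ : ∀ x → 1ᶠ *ᶠ x ≡ x
  *ᶠ-identityˡ x = trans (cong (λ n → ι (n * toℕ x)) toℕ-1ᶠ)
    (trans (cong ι (*-identityˡ (toℕ x))) (ι-toℕ x))

  -ᶠ-inverseʳ : ∀ x → x +ᶠ (-ᶠ x) ≡ 0ᶠ
  -ᶠ-inverseʳ x = begin
    x +ᶠ (-ᶠ x)                     ≡⟨ cong (_+ᶠ (-ᶠ x)) (ι-toℕ x) ⟨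
    ι (toℕ x) +ᶠ ι (p ∸ toℕ x)      ≡⟨ ι-+ _ _ ⟩
    ι (toℕ x + (p ∸ toℕ x))         ≡⟨ cong ι (m+[n∸m]≡n (<⇒≤ (Fin.toℕ<n x))) ⟩
    ι p                             ≡⟨ cong ι (*-identityˡ p) ⟨
    ι (1 * p)                       ≡⟨ ι-p 1 ⟩
    0ᶠ                              ∎
    where open ≡-Reasoning

  open import Algebra.Consequences.Propositional {A = Fin p}
    using (comm∧idˡ⇒id; comm∧invʳ⇒inv; comm∧distrˡ⇒distrʳ)

  𝔽 : CommutativeRing 0ℓ 0ℓ
  𝔽 = record
    { Carrier = Fin p ; _≈_ = _≡_ ; _+_ = _+ᶠ_ ; _*_ = _*ᶠ_ ; -_ = -ᶠ_ ; 0# = 0ᶠ ; 1# = 1ᶠ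
    ; isCommutativeRing = record
      { isRing = record
        { +-isAbelianGroup = record
          { isGroup = record
            { isMonoid = record
              { isSemigroup = record
                { isMagma = record { isEquivalence = isEquivalence ; ∙-cong = cong₂ _+ᶠ_ }
                ; assoc = +ᶠ-assoc }
              ; identity = comm∧idˡ⇒id +ᶠ-comm +ᶠ-identityˡ }
            ; inverse = comm∧invʳ⇒inv +ᶠ-comm -ᶠ-inverseʳ
            ; ⁻¹-cong = cong -ᶠ_ }
          ; comm = +ᶠ-comm }
        ; *-cong = cong₂ _*ᶠ_
        ; *-assoc = *ᶠ-assoc
        ; *-identity = comm∧idˡ⇒id *ᶠ-comm *ᶠ-identityˡ
        ; distrib = *ᶠ-distribˡ-+ᶠ , comm∧distrˡ⇒distrʳ *ᶠ-comm *ᶠ-distribˡ-+ᶠ }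
      ; *-comm = *ᶠ-comm } }

  module 𝔽 = CommutativeRing 𝔽
  open import Algebra.Properties.Ring 𝔽.ring using (-1*x≈-x; -‿distribˡ-*)
  open import Algebra.Properties.Group 𝔽.+-group
    using (//-rightDividesˡ; //-rightDividesʳ; x∙y⁻¹≈ε⇒x≈y; inverseˡ-unique)
  open import Algebra.Properties.CommutativeSemigroup 𝔽.+-commutativeSemigroup using (interchange)

  -- A nonzero residue is coprime to p. Bézout's identity comes in two signs: 1 + z x = y p makes -z
  -- the inverse, and 1 + y p = z x makes it z.
  *ᶠ-inverse : Prime p → ∀ x → x ≢ 0ᶠ → ∃[ c ] c *ᶠ x ≡ 1ᶠ
  *ᶠ-inverse p-prime x x≢0 = fromBézout (coprime-Bézout (prime⇒coprime p-prime (Fin.toℕ<n x)))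
    where
    open ≡-Reasoning
    instance
      x≢0′ : NonZero (toℕ x)
      x≢0′ = ≢-nonZero (λ x≡0 → x≢0 (Fin.toℕ-injective (trans x≡0 (sym toℕ-0ᶠ))))

    ι*x : ∀ z → ι z *ᶠ x ≡ ι (z * toℕ x)
    ι*x z = trans (cong (ι z *ᶠ_) (sym (ι-toℕ x))) (ι-* z (toℕ x))

    fromBézout : Bézout.Identity 1 p (toℕ x) → ∃[ c ] c *ᶠ x ≡ 1ᶠ
    fromBézout (Bézout.+- y z eq) = -ᶠ ι z , (begin
      (-ᶠ ι z) *ᶠ x                 ≡⟨ -‿distribˡ-* (ι z) x ⟨
      -ᶠ (ι z *ᶠ x)                 ≡⟨ inverseˡ-unique 1ᶠ (ι z *ᶠ x) (begin
        1ᶠ +ᶠ ι z *ᶠ x                ≡⟨ cong (1ᶠ +ᶠ_) (ι*x z) ⟩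
        1ᶠ +ᶠ ι (z * toℕ x)           ≡⟨ ι-+ 1 _ ⟩
        ι (1 + z * toℕ x)             ≡⟨ cong ι eq ⟩
        ι (y * p)                     ≡⟨ ι-p y ⟩
        0ᶠ                            ∎) ⟨
      1ᶠ                            ∎)
    fromBézout (Bézout.-+ y z eq) = ι z , (begin
      ι z *ᶠ x                      ≡⟨ ι*x z ⟩
      ι (z * toℕ x)                 ≡⟨ cong ι eq ⟨
      ι (1 + y * p)                 ≡⟨ ι-+ 1 (y * p) ⟨
      1ᶠ +ᶠ ι (y * p)               ≡⟨ cong (1ᶠ +ᶠ_) (ι-p y) ⟩
      1ᶠ +ᶠ 0ᶠ                      ≡⟨ 𝔽.+-identityʳ 1ᶠ ⟩
      1ᶠ                            ∎)

  -- Subtraction of sequences.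

  -1ᶠ : Fin p
  -1ᶠ = -ᶠ 1ᶠ

  -- Built from `⊕` and `⊙`, so that linear maps and subspaces respect it by their two laws.
  _⊝_ : FinSeq p → FinSeq p → FinSeq p
  x ⊝ y = x ⊕ -1ᶠ ⊙ y

  infixl 6 _⊝_

  +-1*≡- : ∀ x y → x +ᶠ -1ᶠ *ᶠ y ≡ x 𝔽.- y
  +-1*≡- x y = cong (x +ᶠ_) (-1*x≈-x y)

  x+-1*y+y≡x : ∀ x y → x +ᶠ -1ᶠ *ᶠ y +ᶠ y ≡ x
  x+-1*y+y≡x x y = trans (cong (_+ᶠ y) (+-1*≡- x y)) (//-rightDividesˡ y x)

  x+-1*x≡0 : ∀ x → x +ᶠ -1ᶠ *ᶠ x ≡ 0ᶠ
  x+-1*x≡0 x = trans (+-1*≡- x x) (-ᶠ-inverseʳ x)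

  x+-1*y≡0⇒x≡y : ∀ x y → x +ᶠ -1ᶠ *ᶠ y ≡ 0ᶠ → x ≡ y
  x+-1*y≡0⇒x≡y x y eq = x∙y⁻¹≈ε⇒x≈y x y (trans (sym (+-1*≡- x y)) eq)

  +ᶠ-cancelʳ : ∀ x y z → y +ᶠ x ≡ z +ᶠ x → y ≡ z
  +ᶠ-cancelʳ x y z eq = trans (sym (//-rightDividesʳ x y)) (trans (cong (𝔽._- x) eq) (//-rightDividesʳ x z))

  +ᶠ-cancelˡ : ∀ x y z → x +ᶠ y ≡ x +ᶠ z → y ≡ z
  +ᶠ-cancelˡ x y z eq = +ᶠ-cancelʳ x y z (trans (+ᶠ-comm y x) (trans eq (+ᶠ-comm x z)))

  1≢0 : 1ᶠ ≢ 0ᶠ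
  1≢0 eq with () ← trans (sym toℕ-1ᶠ) (trans (cong toℕ eq) toℕ-0ᶠ)

  ⊝-⊕-cancel : ∀ x y → (x ⊝ y) ⊕ y ≈ x
  ⊝-⊕-cancel x y i = x+-1*y+y≡x (at x i) (at y i)

  ≈-sym : {x y : FinSeq p} → x ≈ y → y ≈ x
  ≈-sym eq i = sym (eq i)

  ≈-trans : {x y z : FinSeq p} → x ≈ y → y ≈ z → x ≈ z
  ≈-trans eq eq′ i = trans (eq i) (eq′ i)

  -- Linear combinations.

  VanishesFrom : ℕ → FinSeq p → Set
  VanishesFrom n e = ∀ i → n ≤ i → at e i ≡ 0ᶠ

  sumˢ-extend : ∀ g n → (∀ j → n ≤ j → g j ≈ 0ˢ) → ∀ m → sumˢ (m + n) g ≈ sumˢ n g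
  sumˢ-extend g n g≈0 zero    i = refl
  sumˢ-extend g n g≈0 (suc m) i = trans
    (cong₂ _+ᶠ_ (sumˢ-extend g n g≈0 m i) (g≈0 (m + n) (m≤n+m n m) i))
    (𝔽.+-identityʳ _)

  sumˢ-⊕ : ∀ n (g h : ℕ → FinSeq p) → sumˢ n (λ j → g j ⊕ h j) ≈ sumˢ n g ⊕ sumˢ n h
  sumˢ-⊕ zero    g h i = sym (𝔽.+-identityˡ 0ᶠ)
  sumˢ-⊕ (suc n) g h i = trans
    (cong (_+ᶠ at (g n ⊕ h n) i) (sumˢ-⊕ n g h i))
    (interchange (at (sumˢ n g) i) (at (sumˢ n h) i) (at (g n) i) (at (h n) i))

  sumˢ-⊙ : ∀ n c (g : ℕ → FinSeq p) → sumˢ n (λ j → c ⊙ g j) ≈ c ⊙ sumˢ n g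
  sumˢ-⊙ zero    c g i = sym (𝔽.zeroʳ c)
  sumˢ-⊙ (suc n) c g i = trans
    (cong (_+ᶠ at (c ⊙ g n) i) (sumˢ-⊙ n c g i))
    (sym (*ᶠ-distribˡ-+ᶠ c (at (sumˢ n g) i) (at (g n) i)))

  sumˢ-cong : ∀ n {g h : ℕ → FinSeq p} → (∀ j → g j ≈ h j) → sumˢ n g ≈ sumˢ n h
  sumˢ-cong zero    g≈h i = refl
  sumˢ-cong (suc n) g≈h i = cong₂ _+ᶠ_ (sumˢ-cong n g≈h i) (g≈h n i)

  module _ (g : ℕ → FinSeq p) where

    -- `lin` cuts the sum at the stored bound, which need not be sharp. Both cuts are extended by
    -- zero terms to the common length n + `bound e`.
    lin≈sumˢ : ∀ e n → VanishesFrom n e → lin e g ≈ sumˢ n (λ j → at e j ⊙ g j)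
    lin≈sumˢ e n e≡0 i = begin
      at (sumˢ (bound e) h) i        ≡⟨ sumˢ-extend h (bound e) (λ j le → h≈0 j (vanish e j le)) n i ⟨
      at (sumˢ (n + bound e) h) i    ≡⟨ cong (λ m → at (sumˢ m h) i) (+-comm n (bound e)) ⟩
      at (sumˢ (bound e + n) h) i    ≡⟨ sumˢ-extend h n (λ j le → h≈0 j (e≡0 j le)) (bound e) i ⟩
      at (sumˢ n h) i                ∎
      where
      open ≡-Reasoning
      h : ℕ → FinSeq p
      h j = at e j ⊙ g j
      h≈0 : ∀ j → at e j ≡ 0ᶠ → h j ≈ 0ˢ
      h≈0 j eq i = trans (cong (_*ᶠ at (g j) i) eq) (𝔽.zeroˡ _)

    lin-cong : ∀ {e f} → e ≈ f → lin e g ≈ lin f g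
    lin-cong {e} {f} e≈f = ≈-trans {lin e g} {sumˢ (bound f) (λ j → at e j ⊙ g j)} {lin f g}
      (lin≈sumˢ e (bound f) (λ i le → trans (e≈f i) (vanish f i le)))
      (sumˢ-cong (bound f) (λ j i → cong (_*ᶠ at (g j) i) (e≈f j)))

    lin-⊕ : ∀ e f → lin (e ⊕ f) g ≈ lin e g ⊕ lin f g
    lin-⊕ e f i = begin
      at (sumˢ n (λ j → (at e j +ᶠ at f j) ⊙ g j)) i
        ≡⟨ sumˢ-cong n (λ j i → 𝔽.distribʳ (at (g j) i) (at e j) (at f j)) i ⟩
      at (sumˢ n (λ j → at e j ⊙ g j ⊕ at f j ⊙ g j)) i
        ≡⟨ sumˢ-⊕ n _ _ i ⟩
      at (sumˢ n (λ j → at e j ⊙ g j)) i +ᶠ at (sumˢ n (λ j → at f j ⊙ g j)) i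
        ≡⟨ cong₂ _+ᶠ_ (lin≈sumˢ e n (λ j le → vanish e j (m⊔n≤o⇒m≤o (bound e) _ le)) i)
                      (lin≈sumˢ f n (λ j le → vanish f j (m⊔n≤o⇒n≤o (bound e) _ le)) i) ⟨
      at (lin e g) i +ᶠ at (lin f g) i ∎
      where
      open ≡-Reasoning
      n = bound e ⊔ bound f

    lin-⊙ : ∀ c e → lin (c ⊙ e) g ≈ c ⊙ lin e g
    lin-⊙ c e i = trans
      (sumˢ-cong (bound e) (λ j i → *ᶠ-assoc c (at e j) (at (g j) i)) i)
      (sumˢ-⊙ (bound e) c (λ j → at e j ⊙ g j) i)

  -- Unit vectors.

  δ : ℕ → ℕ → Fin p
  δ zero    zero    = 1ᶠ
  δ zero    (suc j) = 0ᶠ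
  δ (suc i) zero    = 0ᶠ
  δ (suc i) (suc j) = δ i j

  δ-diag : ∀ i → δ i i ≡ 1ᶠ
  δ-diag zero    = refl
  δ-diag (suc i) = δ-diag i

  δ-≢ : ∀ i j → i ≢ j → δ i j ≡ 0ᶠ
  δ-≢ zero    zero    i≢j = contradiction refl i≢j
  δ-≢ zero    (suc j) i≢j = refl
  δ-≢ (suc i) zero    i≢j = refl
  δ-≢ (suc i) (suc j) i≢j = δ-≢ i j (i≢j ∘ cong suc)

  unit : ℕ → FinSeq p
  unit i = record { at = δ i ; bound = suc i ; vanish = λ j i<j → δ-≢ i j (<⇒≢ i<j) }

  lin-unit : ∀ g i → lin (unit i) g ≈ g i
  lin-unit g i q = trans
    (cong₂ _+ᶠ_ (below i ≤-refl) (trans (cong (_*ᶠ at (g i) q) (δ-diag i)) (*ᶠ-identityˡ _)))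
    (𝔽.+-identityˡ _)
    where
    below : ∀ n → n ≤ i → at (sumˢ n (λ j → δ i j ⊙ g j)) q ≡ 0ᶠ
    below zero    _   = refl
    below (suc n) n<i = trans
      (cong₂ _+ᶠ_ (below n (<⇒≤ n<i)) (trans (cong (_*ᶠ _) (δ-≢ i n (≢-sym (<⇒≢ n<i)))) (𝔽.zeroˡ _)))
      (𝔽.+-identityˡ 0ᶠ)

  -- The order by the largest differing position.

  infix 4 _≺_

  -- One relation for two uses: `Less F x y` unfolds to `coord x ≺ coord y`, and on digit functions
  -- it is the order of ℕ (`digits-mono`, `digits-reflects-<`).
  _≺_ : (f g : ℕ → Fin p) → Set
  f ≺ g = ∃[ N ] f N Fin.< g N × (∀ i → N < i → f i ≡ g i)

  ≺-irrefl : ∀ {f g} → (∀ i → f i ≡ g i) → ¬ f ≺ g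
  ≺-irrefl f≗g (N , f<g , _) = <⇒≢ f<g (cong toℕ (f≗g N))

  ≺-asym : ∀ {f g} → f ≺ g → ¬ g ≺ f
  ≺-asym (M , f<g , above) (N , g<f , above′) with <-cmp M N
  ... | tri< M<N _ _  = <⇒≢ g<f (cong toℕ (sym (above N M<N)))
  ... | tri≈ _ refl _ = <-asym f<g g<f
  ... | tri> _ _ N<M  = <⇒≢ f<g (cong toℕ (sym (above′ M N<M)))

  -- Downward search from n; each position of agreement that is found lowers the bound by one.
  topDifference : ∀ (f g : ℕ → Fin p) n → (∀ i → n ≤ i → f i ≡ g i) →
                  (∀ i → f i ≡ g i) ⊎ (∃[ N ] f N ≢ g N × (∀ i → N < i → f i ≡ g i))
  topDifference f g zero    agree = inj₁ (λ i → agree i z≤n)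
  topDifference f g (suc n) agree with f n Fin.≟ g n
  ... | no f≢g  = inj₂ (n , f≢g , agree)
  ... | yes f≡g = topDifference f g n λ i n≤i →
    [ agree i , (λ { refl → f≡g }) ]′ (m≤n⇒m<n∨m≡n n≤i)

  data Order (f g : ℕ → Fin p) : Set where
    less    : f ≺ g → Order f g
    equal   : (∀ i → f i ≡ g i) → Order f g
    greater : g ≺ f → Order f g

  ≺-compare : ∀ (x y : FinSeq p) → Order (at x) (at y)
  ≺-compare x y with topDifference (at x) (at y) (bound x ⊔ bound y)
                       (λ i le → trans (vanish x i (m⊔n≤o⇒m≤o (bound x) _ le))
                                       (sym (vanish y i (m⊔n≤o⇒n≤o (bound x) _ le))))
  ... | inj₁ x≈y = equal x≈y
  ... | inj₂ (N , x≢y , above) with Fin.<-cmp (at x N) (at y N)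
  ...   | tri< x<y _ _ = less (N , x<y , above)
  ...   | tri≈ _ x≡y _ = contradiction x≡y x≢y
  ...   | tri> _ _ y<x = greater (N , y<x , λ i lt → sym (above i lt))

  ≢0⇒0< : ∀ {x : Fin p} → x ≢ 0ᶠ → 0 < toℕ x
  ≢0⇒0< x≢0 = n≢0⇒n>0 λ x≡0 → x≢0 (Fin.toℕ-injective (trans x≡0 (sym toℕ-0ᶠ)))

  ≮0 : ∀ {x y : Fin p} → y ≡ 0ᶠ → ¬ x Fin.< y
  ≮0 {x} refl x<0 = n≮0 (subst (toℕ x <_) toℕ-0ᶠ x<0)

  -- The p-ary expansion.

  digit-0 : ∀ i → digit {p} 0 i ≡ 0ᶠ
  digit-0 i = vanish (digits 0) i z≤n

  digit-< : ∀ k {a i} → a < p ^ k → k ≤ i → digit {p} a i ≡ 0ᶠ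
  digit-< zero    {zero} {i} a<1 _ = digit-0 i
  digit-< zero    {suc _} (s≤s ()) _
  digit-< (suc k) {a} a<p (s≤s k≤i) = digit-< k (m<n*o⇒m/o<n (subst (a <_) (*-comm p (p ^ k)) a<p)) k≤i

  digit≢0⇒p^≤ : ∀ a i → digit a i ≢ 0ᶠ → p ^ i ≤ a
  digit≢0⇒p^≤ a i d≢0 with p ^ i ≤? a
  ... | yes le = le
  ... | no nle = contradiction (digit-< i (≰⇒> nle) ≤-refl) d≢0

  -- Strong induction through division by p: if the quotients differ, their top difference is moved
  -- up by one position; if they are equal, the remainders decide at position 0.
  digits-mono : ∀ {a b} → a < b → digit a ≺ digit b
  digits-mono {a} {b} = <-rec (λ b → ∀ a → a < b → digit a ≺ digit b) step b a
    where
    step : ∀ b → (∀ {b′} → b′ < b → ∀ a → a < b′ → digit a ≺ digit b′) → ∀ a → a < b → digit a ≺ digit b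
    step b@(suc _) rec a a<b with m≤n⇒m<n∨m≡n (/-monoˡ-≤ p (<⇒≤ a<b))
    ... | inj₁ a/p<b/p with (N , lt , above) ← rec (m/n<m b p (nonTrivial⇒n>1 p)) (a / p) a/p<b/p =
      suc N , lt , λ { (suc i) (s≤s N<i) → above i N<i }
    ... | inj₂ a/p≡b/p = 0 , subst₂ _<_ (sym (toℕ-ι a)) (sym (toℕ-ι b)) a%p<b%p ,
      λ { (suc i) _ → cong (λ c → digit c i) a/p≡b/p }
      where
      a%p<b%p : a % p < b % p
      a%p<b%p = +-cancelʳ-< (b / p * p) (a % p) (b % p) (subst₂ _<_
        (trans (m≡m%n+[m/n]*n a p) (cong (λ c → a % p + c * p) a/p≡b/p)) (m≡m%n+[m/n]*n b p) a<b)

  digits-reflects-< : ∀ {a b} → digit a ≺ digit b → a < b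
  digits-reflects-< {a} {b} a≺b with <-cmp a b
  ... | tri< a<b _ _  = a<b
  ... | tri≈ _ refl _ = contradiction a≺b (≺-irrefl (λ _ → refl))
  ... | tri> _ _ b<a  = contradiction a≺b (≺-asym (digits-mono b<a))

  -- Horner's rule: the lowest digit is split off and the rest is multiplied by p.
  fromDigits : ∀ k (f : ℕ → Fin p) → (∀ i → k ≤ i → f i ≡ 0ᶠ) →
               ∃[ a ] a < p ^ k × (∀ i → digit a i ≡ f i)
  fromDigits zero    f f≡0 = 0 , z<s , λ i → trans (digit-0 i) (sym (f≡0 i z≤n))
  fromDigits (suc k) f f≡0
    with (a , a<p^k , a≗f) ← fromDigits k (f ∘ suc) (λ i k≤i → f≡0 (suc i) (s≤s k≤i))
    = toℕ (f 0) + a * p , lt , λ where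
        zero    → trans (ι-cong-% ([m+kn]%n≡m%n (toℕ (f 0)) a p)) (ι-toℕ (f 0))
        (suc i) → trans (cong (λ b → digit b i) quotient) (a≗f i)
    where
    lt : toℕ (f 0) + a * p < p * p ^ k
    lt = begin-strict
      toℕ (f 0) + a * p   <⟨ +-monoˡ-< (a * p) (Fin.toℕ<n (f 0)) ⟩
      suc a * p           ≤⟨ *-monoˡ-≤ p a<p^k ⟩
      p ^ k * p           ≡⟨ *-comm (p ^ k) p ⟩
      p * p ^ k           ∎
      where open ≤-Reasoning
    quotient : (toℕ (f 0) + a * p) / p ≡ a
    quotient = begin
      (toℕ (f 0) + a * p) / p       ≡⟨ +-distrib-/-∣ʳ (toℕ (f 0)) (divides-refl a) ⟩
      toℕ (f 0) / p + a * p / p     ≡⟨ cong₂ _+_ (m<n⇒m/n≡0 (Fin.toℕ<n (f 0))) (m*n/n≡m a p) ⟩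
      a                             ∎
      where open ≡-Reasoning

  x-c*0≡x : ∀ x c {y} → y ≡ 0ᶠ → x +ᶠ -1ᶠ *ᶠ (c *ᶠ y) ≡ x
  x-c*0≡x x c refl = trans
    (cong (x +ᶠ_) (trans (cong (-1ᶠ *ᶠ_) (𝔽.zeroʳ c)) (𝔽.zeroʳ -1ᶠ)))
    (𝔽.+-identityʳ x)

  -- With z ≤ y ≤ x as integers, x - y + z stays between 0 and x, so there is no wrap-around modulo
  -- p. This is what allows digits of sums and differences to be compared.
  toℕ-shift : ∀ x y z → toℕ z ≤ toℕ y → toℕ y ≤ toℕ x →
              toℕ (x +ᶠ -1ᶠ *ᶠ y +ᶠ z) ≡ toℕ x ∸ toℕ y + toℕ z
  toℕ-shift x y z z≤y y≤x = trans (cong toℕ eq) (toℕ-ι-< lt)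
    where
    x-y≡ι : x +ᶠ -1ᶠ *ᶠ y ≡ ι (toℕ x ∸ toℕ y)
    x-y≡ι = +ᶠ-cancelʳ y _ _ (begin
      x +ᶠ -1ᶠ *ᶠ y +ᶠ y                    ≡⟨ x+-1*y+y≡x x y ⟩
      x                                     ≡⟨ ι-toℕ x ⟨
      ι (toℕ x)                             ≡⟨ cong ι (m∸n+n≡m y≤x) ⟨
      ι (toℕ x ∸ toℕ y + toℕ y)             ≡⟨ ι-+ _ _ ⟨
      ι (toℕ x ∸ toℕ y) +ᶠ ι (toℕ y)        ≡⟨ cong (ι (toℕ x ∸ toℕ y) +ᶠ_) (ι-toℕ y) ⟩
      ι (toℕ x ∸ toℕ y) +ᶠ y                ∎)
      where open ≡-Reasoning
    eq : x +ᶠ -1ᶠ *ᶠ y +ᶠ z ≡ ι (toℕ x ∸ toℕ y + toℕ z)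
    eq = trans (cong₂ _+ᶠ_ x-y≡ι (sym (ι-toℕ z))) (ι-+ _ _)
    lt : toℕ x ∸ toℕ y + toℕ z < p
    lt = begin-strict
      toℕ x ∸ toℕ y + toℕ z   ≤⟨ +-monoʳ-≤ (toℕ x ∸ toℕ y) z≤y ⟩
      toℕ x ∸ toℕ y + toℕ y   ≡⟨ m∸n+n≡m y≤x ⟩
      toℕ x                   <⟨ Fin.toℕ<n x ⟩
      p                       ∎
      where open ≤-Reasoning

  -- The Hamming distance.

  length-filter-extend : ∀ {P : Pred ℕ 0ℓ} (P? : Decidable P) n → (∀ i → n ≤ i → ¬ P i) → ∀ m →
                         length (filter P? (upTo (m + n))) ≡ length (filter P? (upTo n))
  length-filter-extend P? n ¬P zero    = refl
  length-filter-extend P? n ¬P (suc m) = begin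
    length (filter P? (upTo (suc (m + n))))
      ≡⟨ cong (length ∘ filter P?) (upTo-∷ʳ (m + n)) ⟨
    length (filter P? (upTo (m + n) ++ [ m + n ]))
      ≡⟨ cong length (filter-++ P? (upTo (m + n)) [ m + n ]) ⟩
    length (filter P? (upTo (m + n)) ++ filter P? [ m + n ])
      ≡⟨ cong (λ l → length (filter P? (upTo (m + n)) ++ l)) (filter-reject P? (¬P (m + n) (m≤n+m n m))) ⟩
    length (filter P? (upTo (m + n)) ++ [])
      ≡⟨ cong length (++-identityʳ (filter P? (upTo (m + n)))) ⟩
    length (filter P? (upTo (m + n)))
      ≡⟨ length-filter-extend P? n ¬P m ⟩
    length (filter P? (upTo n)) ∎
    where open ≡-Reasoning

  length-filter-mono : ∀ {P Q : Pred ℕ 0ℓ} (P? : Decidable P) (Q? : Decidable Q) → (∀ {i} → P i → Q i) →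
                       ∀ l → length (filter P? l) ≤ length (filter Q? l)
  length-filter-mono P? Q? P⇒Q []      = z≤n
  length-filter-mono P? Q? P⇒Q (i ∷ l) with P? i | Q? i
  ... | yes Pi | yes _  = s≤s (length-filter-mono P? Q? P⇒Q l)
  ... | yes Pi | no ¬Qi = contradiction (P⇒Q Pi) ¬Qi
  ... | no _   | yes _  = m≤n⇒m≤1+n (length-filter-mono P? Q? P⇒Q l)
  ... | no _   | no _   = length-filter-mono P? Q? P⇒Q l

  -- The differing positions of the first pair are among those of the second; both counts are taken
  -- over the common range n + n′. All distance estimates below are obtained in this way.
  dist-mono : ∀ (x y x′ y′ : FinSeq p) → (∀ i → at x′ i ≡ at y′ i → at x i ≡ at y i) →
              dist x y ≤ dist x′ y′
  dist-mono x y x′ y′ agree = begin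
    length (filter P? (upTo n))           ≡⟨ length-filter-extend P? n (agreeFrom x y) n′ ⟨
    length (filter P? (upTo (n′ + n)))    ≤⟨ length-filter-mono P? Q? P⇒Q (upTo (n′ + n)) ⟩
    length (filter Q? (upTo (n′ + n)))    ≡⟨ cong (length ∘ filter Q? ∘ upTo) (+-comm n′ n) ⟩
    length (filter Q? (upTo (n + n′)))    ≡⟨ length-filter-extend Q? n′ (agreeFrom x′ y′) n ⟩
    length (filter Q? (upTo n′))          ∎
    where
    open ≤-Reasoning
    n  = bound x ⊔ bound y
    n′ = bound x′ ⊔ bound y′
    P? = λ i → ¬? (at x i Fin.≟ at y i)
    Q? = λ i → ¬? (at x′ i Fin.≟ at y′ i)
    P⇒Q : ∀ {i} → at x i ≢ at y i → at x′ i ≢ at y′ i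
    P⇒Q x≢y = x≢y ∘ agree _
    agreeFrom : ∀ (x y : FinSeq p) i → bound x ⊔ bound y ≤ i → ¬ at x i ≢ at y i
    agreeFrom x y i le x≢y = x≢y (trans (vanish x i (m⊔n≤o⇒m≤o (bound x) _ le))
                                        (sym (vanish y i (m⊔n≤o⇒n≤o (bound x) _ le))))

  dist-≈ : ∀ {x y : FinSeq p} → x ≈ y → dist x y ≡ 0
  dist-≈ {x} {y} x≈y = n≤0⇒n≡0 (dist-mono x y 0ˢ 0ˢ (λ i _ → x≈y i))

  -- Linear functionals and the coordinates of F.

  record IsLinear (L : FinSeq p → Fin p) : Set where
    field
      resp-≈ : ∀ {x y} → x ≈ y → L x ≡ L y
      resp-⊕ : ∀ x y → L (x ⊕ y) ≡ L x +ᶠ L y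
      resp-⊙ : ∀ c x → L (c ⊙ x) ≡ c *ᶠ L x

    resp-⊝ : ∀ x y → L (x ⊝ y) ≡ L x +ᶠ -1ᶠ *ᶠ L y
    resp-⊝ x y = trans (resp-⊕ x (-1ᶠ ⊙ y)) (cong (L x +ᶠ_) (resp-⊙ -1ᶠ y))

    resp-0 : L 0ˢ ≡ 0ᶠ
    resp-0 = trans (resp-≈ {0ˢ} {0ᶠ ⊙ 0ˢ} (λ _ → sym (𝔽.zeroˡ 0ᶠ))) (trans (resp-⊙ 0ᶠ 0ˢ) (𝔽.zeroˡ (L 0ˢ)))

  open IsLinear

  lin-isLinear : ∀ g {L} → IsLinear L → IsLinear (λ e → L (lin e g))
  lin-isLinear g L-lin .resp-≈ {e} {f} e≈f = resp-≈ L-lin {lin e g} {lin f g} (lin-cong g {e} {f} e≈f)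
  lin-isLinear g L-lin .resp-⊕ e f = trans
    (resp-≈ L-lin {lin (e ⊕ f) g} {lin e g ⊕ lin f g} (lin-⊕ g e f))
    (resp-⊕ L-lin (lin e g) (lin f g))
  lin-isLinear g L-lin .resp-⊙ c e = trans
    (resp-≈ L-lin {lin (c ⊙ e) g} {c ⊙ lin e g} (lin-⊙ g c e))
    (resp-⊙ L-lin c (lin e g))

  at-isLinear : ∀ i → IsLinear (λ x → at x i)
  at-isLinear i = record { resp-≈ = λ x≈y → x≈y i ; resp-⊕ = λ _ _ → refl ; resp-⊙ = λ _ _ → refl }

  module _ (F : OrderedBasis p) where
    open OrderedBasis F

    coordinates : FinSeq p → FinSeq p
    coordinates x = proj₁ (spanning x)

    -- `spanning` merely chooses an expansion; `independent`, applied to the difference of two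
    -- expansions, shows that the choice does not matter. Linearity of `coord` follows.
    coord-unique : ∀ x c → x ≈ lin c vec → ∀ i → coord x i ≡ at c i
    coord-unique x c x≈ i = x+-1*y≡0⇒x≡y (coord x i) (at c i)
      (independent (coordinates x ⊝ c) (λ q → trans
        (resp-⊝ (lin-isLinear vec (at-isLinear q)) (coordinates x) c)
        (trans (cong (λ y → y +ᶠ -1ᶠ *ᶠ at (lin c vec) q) (trans (sym (proj₂ (spanning x) q)) (x≈ q)))
               (x+-1*x≡0 (at (lin c vec) q)))) i)

    coord-isLinear : ∀ i → IsLinear (λ x → coord x i)
    coord-isLinear i .resp-≈ {x} {y} x≈y =
      coord-unique x (coordinates y) (λ q → trans (x≈y q) (proj₂ (spanning y) q)) i
    coord-isLinear i .resp-⊕ x y =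
      coord-unique (x ⊕ y) (coordinates x ⊕ coordinates y)
        (λ q → trans (cong₂ _+ᶠ_ (proj₂ (spanning x) q) (proj₂ (spanning y) q))
                     (sym (lin-⊕ vec (coordinates x) (coordinates y) q))) i
    coord-isLinear i .resp-⊙ c x =
      coord-unique (c ⊙ x) (c ⊙ coordinates x)
        (λ q → trans (cong (c *ᶠ_) (proj₂ (spanning x) q)) (sym (lin-⊙ vec c (coordinates x) q))) i

  -- Partial multisets of units for the pigeonhole argument.

  -- The first m units of the multiset that contains e i copies of i.
  takeUnits : ℕ → (ℕ → ℕ) → ℕ → ℕ
  takeUnits m e zero    = m ⊓ e 0
  takeUnits m e (suc i) = takeUnits (m ∸ e 0) (e ∘ suc) i

  takeUnits-≤ : ∀ m e i → takeUnits m e i ≤ e i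
  takeUnits-≤ m e zero    = m⊓n≤n m (e 0)
  takeUnits-≤ m e (suc i) = takeUnits-≤ (m ∸ e 0) (e ∘ suc) i

  takeUnits-mono : ∀ {m m′} e → m ≤ m′ → ∀ i → takeUnits m e i ≤ takeUnits m′ e i
  takeUnits-mono e m≤m′ zero    = ⊓-monoˡ-≤ (e 0) m≤m′
  takeUnits-mono e m≤m′ (suc i) = takeUnits-mono (e ∘ suc) (∸-monoˡ-≤ (e 0) m≤m′) i

  -- Taking more units changes some multiplicity until the multiset is exhausted, so equal results
  -- mean that at most m units exist.
  takeUnits-saturates : ∀ {m m′} e → m < m′ → (∀ i → takeUnits m e i ≡ takeUnits m′ e i) →
                        ∀ n → sum (applyUpTo e n) ≤ m
  takeUnits-saturates e m<m′ eq zero = z≤n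
  takeUnits-saturates {m} {m′} e m<m′ eq (suc n) with ≤-total (e 0) m
  ... | inj₁ e₀≤m = begin
    e 0 + sum (applyUpTo (e ∘ suc) n)
      ≤⟨ +-monoʳ-≤ (e 0) (takeUnits-saturates (e ∘ suc) (∸-monoˡ-< m<m′ e₀≤m) (eq ∘ suc) n) ⟩
    e 0 + (m ∸ e 0)                     ≡⟨ m+[n∸m]≡n e₀≤m ⟩
    m                                   ∎
    where open ≤-Reasoning
  ... | inj₂ m≤e₀ with m≤n⇒m<n∨m≡n m≤e₀
  -- Copies of 0 are still left after m units, so the longer selection contains more of them.
  ...   | inj₁ m<e₀ = contradiction (trans (sym (m≤n⇒m⊓n≡m m≤e₀)) (eq 0)) (<⇒≢ (⊓-pres-m< m<m′ m<e₀))
  ...   | inj₂ refl = begin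
    m + sum (applyUpTo (e ∘ suc) n)
      ≤⟨ +-monoʳ-≤ m (takeUnits-saturates (e ∘ suc) (∸-monoˡ-< m<m′ ≤-refl) (eq ∘ suc) n) ⟩
    m + (m ∸ m)                         ≡⟨ m+[n∸m]≡n (≤-refl {m}) ⟩
    m                                   ∎
    where open ≤-Reasoning

  -- Lexicographic words and the map φ.

  module _ (p-prime : Prime p) {d : ℕ} (2≤d : 2 ≤ d) (F : OrderedBasis p)
           (w : ℕ → FinSeq p) (w-lex : IsLexWords F d w) where
    open OrderedBasis F using (coord)

    -- (w ⁺) a is φ (digits a) by definition.
    φ : FinSeq p → FinSeq p
    φ e = lin e (λ i → w (p ^ i))

    ψ : FinSeq p → ℕ → Fin p
    ψ e = coord (φ e)

    φ-lin : ∀ i → IsLinear (λ e → at (φ e) i)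
    φ-lin i = lin-isLinear (λ j → w (p ^ j)) (at-isLinear i)

    coord-lin : ∀ i → IsLinear (λ x → coord x i)
    coord-lin = coord-isLinear F

    ψ-lin : ∀ i → IsLinear (λ e → ψ e i)
    ψ-lin i = lin-isLinear (λ j → w (p ^ j)) (coord-lin i)

    φ-cong : ∀ {e f} → e ≈ f → φ e ≈ φ f
    φ-cong {e} {f} e≈f i = resp-≈ (φ-lin i) {e} {f} e≈f

    φ-unit : ∀ i → w (p ^ i) ≈ φ (unit i)
    φ-unit i q = sym (lin-unit (λ j → w (p ^ j)) i q)

    coord-cong : ∀ {x y} → x ≈ y → ∀ i → coord x i ≡ coord y i
    coord-cong {x} {y} x≈y i = resp-≈ (coord-lin i) {x} {y} x≈y

    w-minimal : ∀ a z → (∀ b → b < a → d ≤ dist z (w b)) → w a ≈ z ⊎ Less F (w a) z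
    w-minimal a z = proj₂ (w-lex a) z

    ¬d≤dist : ∀ {x y : FinSeq p} → x ≈ y → ¬ d ≤ dist x y
    ¬d≤dist {x} {y} x≈y d≤ = <⇒≢ (≤-trans (<⇒≤ 2≤d) d≤) (sym (dist-≈ {x = x} {y} x≈y))

    w-distinct : ∀ {a b} → b < a → ¬ w a ≈ w b
    w-distinct {a} {b} b<a eq = ¬d≤dist {w a} {w b} eq (proj₁ (w-lex a) b b<a)

    -- `w b` satisfies every constraint imposed on `w a`, so the minimum `w a` is not above it;
    -- distance at least d rules out equality.
    w-mono : ∀ {a b} → a < b → Less F (w a) (w b)
    w-mono {a} {b} a<b with w-minimal a (w b) (λ c c<a → proj₁ (w-lex b) c (<-trans c<a a<b))
    ... | inj₁ eq = contradiction (≈-sym {w a} {w b} eq) (w-distinct a<b)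
    ... | inj₂ lt = lt

    w-reflects-< : ∀ {a b} → Less F (w a) (w b) → a < b
    w-reflects-< {a} {b} wa<wb with <-cmp a b
    ... | tri< a<b _ _  = a<b
    ... | tri≈ _ refl _ = contradiction wa<wb (≺-irrefl (λ _ → refl))
    ... | tri> _ _ b<a  = contradiction wa<wb (≺-asym (w-mono b<a))

    w-zero : w 0 ≈ 0ˢ
    w-zero with w-minimal 0 0ˢ (λ _ ())
    ... | inj₁ eq            = eq
    ... | inj₂ (N , lt , _) = contradiction lt (≮0 (resp-0 (coord-lin N)))

    -- The induction hypothesis shared by both implications to (2).
    Agree : ℕ → Set
    Agree n = ∀ b → b < n → w b ≈ φ (digits b)

    index : ∀ e → ∃[ a ] digits a ≈ e
    index e with (a , _ , eq) ← fromDigits (bound e) (at e) (vanish e) = a , eq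

    ≺-index : ∀ {a b} e → digits b ≈ e → at e ≺ digit a → b < a
    ≺-index e eq (N , lt , above) =
      digits-reflects-< (N , subst (Fin._< _) (sym (eq N)) lt , λ i N<i → trans (eq i) (above i N<i))

    w≈φ : ∀ {n b e} → Agree n → b < n → digits b ≈ e → w b ≈ φ e
    w≈φ {b = b} {e} agree b<n eq i = trans (agree b b<n i) (φ-cong {digits b} {e} eq i)

    -- Scaling the difference of e and f to have top digit 1 turns it into unit M - r with r supported
    -- below M, and φ r is a word of index less than p ^ M.
    φ-separated : ∀ {n} → Agree n → ∀ e f M → at e M ≢ at f M → (∀ i → M < i → at e i ≡ at f i) →
                  p ^ M ≤ n → d ≤ dist (φ e) (φ f)
    φ-separated {n} agree e f M e≢f above p^M≤n =
      -- Where `φ e` and `φ f` agree, `φ (e ⊝ f)` vanishes, so `w (p ^ M)` agrees with `φ r`, which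
      -- is `w b`. The distance of these two words thus bounds the one sought.
      ≤-trans (proj₁ (w-lex (p ^ M)) b b<p^M) (dist-mono (w (p ^ M)) (w b) (φ e) (φ f) λ i φe≡φf → begin
          at (w (p ^ M)) i
            ≡⟨ φ-unit M i ⟩
          at (φ (unit M)) i
            ≡⟨ x-c*0≡x (at (φ (unit M)) i) c (φ-e-f≡0 i φe≡φf) ⟨
          at (φ (unit M)) i +ᶠ -1ᶠ *ᶠ (c *ᶠ at (φ (e ⊝ f)) i)
            ≡⟨ cong (λ y → at (φ (unit M)) i +ᶠ -1ᶠ *ᶠ y) (resp-⊙ (φ-lin i) c (e ⊝ f)) ⟨
          at (φ (unit M)) i +ᶠ -1ᶠ *ᶠ at (φ (c ⊙ (e ⊝ f))) i
            ≡⟨ resp-⊝ (φ-lin i) (unit M) (c ⊙ (e ⊝ f)) ⟨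
          at (φ (unit M ⊝ c ⊙ (e ⊝ f))) i
            ≡⟨ w≈φ {e = r} agree (<-≤-trans b<p^M p^M≤n) b≈r i ⟨
          at (w b) i ∎)
      where
      open ≡-Reasoning
      inverse : ∃[ c ] c *ᶠ at (e ⊝ f) M ≡ 1ᶠ
      inverse = *ᶠ-inverse p-prime (at (e ⊝ f) M) (e≢f ∘ x+-1*y≡0⇒x≡y (at e M) (at f M))
      c = proj₁ inverse
      c*[e-f]≡1 = proj₂ inverse
      r : FinSeq p
      r = unit M ⊝ c ⊙ (e ⊝ f)
      φ-e-f≡0 : ∀ i → at (φ e) i ≡ at (φ f) i → at (φ (e ⊝ f)) i ≡ 0ᶠ
      φ-e-f≡0 i eq = trans (resp-⊝ (φ-lin i) e f)
        (trans (cong (λ y → y +ᶠ -1ᶠ *ᶠ at (φ f) i) eq) (x+-1*x≡0 (at (φ f) i)))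
      r≡0 : VanishesFrom M r
      r≡0 i M≤i = [ r-above , (λ { refl → r-top }) ]′ (m≤n⇒m<n∨m≡n M≤i)
        where
        r-above : M < i → at r i ≡ 0ᶠ
        r-above M<i = trans
          (x-c*0≡x (δ M i) c (trans (cong (λ y → y +ᶠ -1ᶠ *ᶠ at f i) (above i M<i)) (x+-1*x≡0 (at f i))))
          (δ-≢ M i (<⇒≢ M<i))
        r-top : at r M ≡ 0ᶠ
        r-top = trans (cong₂ (λ x y → x +ᶠ -1ᶠ *ᶠ y) (δ-diag M) c*[e-f]≡1) (x+-1*x≡0 1ᶠ)
      word : ∃[ b ] b < p ^ M × digits b ≈ r
      word = fromDigits M (at r) r≡0
      b = proj₁ word
      b<p^M = proj₁ (proj₂ word)
      b≈r = proj₂ (proj₂ word)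

    w≼φ : ∀ a → Agree a → w a ≈ φ (digits a) ⊎ Less F (w a) (φ (digits a))
    w≼φ a agree = w-minimal a (φ (digits a)) constraint
      where
      constraint : ∀ b → b < a → d ≤ dist (φ (digits a)) (w b)
      constraint b b<a = ≤-trans
        (φ-separated agree (digits a) (digits b) M
          (λ eq → <⇒≢ lt (cong toℕ (sym eq)))
          (λ i M<i → sym (above i M<i))
          -- The digit of a at M exceeds another digit, so it is nonzero and p ^ M ≤ a.
          (digit≢0⇒p^≤ a M (λ eq → ≮0 {digit b M} {digit a M} eq lt)))
        (dist-mono (φ (digits a)) (φ (digits b)) (φ (digits a)) (w b) (λ i eq → trans eq (agree b b<a i)))
        where
        M = proj₁ (digits-mono b<a)
        lt = proj₁ (proj₂ (digits-mono b<a))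
        above = proj₂ (proj₂ (digits-mono b<a))

    -- From (3) to (2): the exchange argument.

    -- The word w a - φ (digits a - f) is admissible at the index of f.
    exchange : ∀ {a} → Agree a → ∀ f → (∀ i → toℕ (at f i) ≤ toℕ (digit a i)) → at f ≺ digit a →
               ∀ {M} → coord (w a) M Fin.< ψ (digits a) M → (∀ i → M < i → coord (w a) i ≡ ψ (digits a) i) →
               ψ f M ≢ ψ (digits a) M
    exchange {a} agree f f≤e f≺e {M} lt above ψf≡ψe = conclude (w-minimal m z′ constraint)
      where
      open ≡-Reasoning
      e = digits a
      z = w a
      z′ = z ⊝ φ (e ⊝ f)
      m = proj₁ (index f)
      m≈f = proj₂ (index f)

      m<a : m < a
      m<a = ≺-index f m≈f f≺e

      wm≈φf : w m ≈ φ f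
      wm≈φf = w≈φ {e = f} agree m<a m≈f

      constraint : ∀ b → b < m → d ≤ dist z′ (w b)
      constraint b b<m =
        -- Translation by `φ (e ⊝ f)`: where z′ agrees with `w b`, z agrees with `φ h`, which is the
        -- earlier word `w m′`.
        ≤-trans (proj₁ (w-lex a) m′ m′<a) (dist-mono z (w m′) z′ (w b) λ i z′≡wb → begin
          at z i                                     ≡⟨ ⊝-⊕-cancel z (φ (e ⊝ f)) i ⟨
          at z′ i +ᶠ at (φ (e ⊝ f)) i                ≡⟨ cong (_+ᶠ at (φ (e ⊝ f)) i)
                                                          (trans z′≡wb (agree b (<-trans b<m m<a) i)) ⟩
          at (φ (digits b)) i +ᶠ at (φ (e ⊝ f)) i    ≡⟨ +ᶠ-comm (at (φ (digits b)) i) (at (φ (e ⊝ f)) i) ⟩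
          at (φ (e ⊝ f)) i +ᶠ at (φ (digits b)) i    ≡⟨ resp-⊕ (φ-lin i) (e ⊝ f) (digits b) ⟨
          at (φ h) i                                 ≡⟨ w≈φ {e = h} agree m′<a m′≈h i ⟨
          at (w m′) i                                ∎)
        where
        h = (e ⊝ f) ⊕ digits b
        m′ = proj₁ (index h)
        m′≈h = proj₂ (index h)
        N = proj₁ (digits-mono b<m)
        b<f = proj₁ (proj₂ (digits-mono b<m))
        b≡f = proj₂ (proj₂ (digits-mono b<m))
        b<f′ : toℕ (digit b N) < toℕ (at f N)
        b<f′ = subst (digit b N Fin.<_) (m≈f N) b<f
        -- Above N, h equals e; at N its digit is that of e lowered by the gap between f and b,
        -- without wrap-around because f ≤ e there.
        m′<a : m′ < a
        m′<a = ≺-index h m′≈h (N ,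
          subst (_< toℕ (at e N)) (sym (toℕ-shift (at e N) (at f N) (digit b N) (<⇒≤ b<f′) (f≤e N)))
            (<-≤-trans (+-monoʳ-< (toℕ (at e N) ∸ toℕ (at f N)) b<f′) (≤-reflexive (m∸n+n≡m (f≤e N)))) ,
          λ i N<i → trans (cong (at (e ⊝ f) i +ᶠ_) (trans (b≡f i N<i) (m≈f i))) (⊝-⊕-cancel e f i))

      coord-z′+ : ∀ i → coord z′ i +ᶠ ψ (e ⊝ f) i ≡ coord z i
      coord-z′+ i = trans (sym (resp-⊕ (coord-lin i) z′ (φ (e ⊝ f))))
        (coord-cong {z′ ⊕ φ (e ⊝ f)} {z} (⊝-⊕-cancel z (φ (e ⊝ f))) i)

      ψf+ : ∀ i → ψ f i +ᶠ ψ (e ⊝ f) i ≡ ψ e i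
      ψf+ i = trans (+ᶠ-comm (ψ f i) (ψ (e ⊝ f) i)) (trans (sym (resp-⊕ (ψ-lin i) (e ⊝ f) f))
        (resp-≈ (ψ-lin i) {(e ⊝ f) ⊕ f} {e} (⊝-⊕-cancel e f)))

      coord-z′≢ψf : coord z′ M ≢ ψ f M
      coord-z′≢ψf eq = <⇒≢ lt (cong toℕ (begin
        coord z M                       ≡⟨ coord-z′+ M ⟨
        coord z′ M +ᶠ ψ (e ⊝ f) M       ≡⟨ cong (_+ᶠ ψ (e ⊝ f) M) eq ⟩
        ψ f M +ᶠ ψ (e ⊝ f) M            ≡⟨ ψf+ M ⟩
        ψ e M                           ∎))

      conclude : ¬ (w m ≈ z′ ⊎ Less F (w m) z′)
      conclude (inj₁ eq) = coord-z′≢ψf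
        (trans (sym (coord-cong {w m} {z′} eq M)) (coord-cong {w m} {φ f} wm≈φf M))
      -- z′ and `φ f` differ by the same vector as z and `φ e`, so M is also their top difference,
      -- and N can only be M.
      conclude (inj₂ (N , lt′ , above′)) with <-cmp N M
      ... | tri< N<M _ _ = coord-z′≢ψf (trans (sym (above′ M N<M)) (coord-cong {w m} {φ f} wm≈φf M))
      ... | tri> _ _ M<N = <⇒≢ lt′ (cong toℕ (trans (coord-cong {w m} {φ f} wm≈φf N)
        (+ᶠ-cancelʳ (ψ (e ⊝ f) N) _ _ (begin
          ψ f N +ᶠ ψ (e ⊝ f) N            ≡⟨ ψf+ N ⟩
          ψ e N                           ≡⟨ above N M<N ⟨
          coord z N                       ≡⟨ coord-z′+ N ⟨
          coord z′ N +ᶠ ψ (e ⊝ f) N       ∎))))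
      -- Now the translation contributes 0 at M, so `w m` below z′ would put `φ e` below z there.
      ... | tri≈ _ refl _ = <-asym lt (subst₂ Fin._<_
        (trans (coord-cong {w m} {φ f} wm≈φf M) ψf≡ψe) z′≡z lt′)
        where
        ψ[e-f]≡0 : ψ (e ⊝ f) M ≡ 0ᶠ
        ψ[e-f]≡0 = begin
          ψ (e ⊝ f) M                     ≡⟨ resp-⊝ (ψ-lin M) e f ⟩
          ψ e M +ᶠ -1ᶠ *ᶠ ψ f M           ≡⟨ cong (λ y → ψ e M +ᶠ -1ᶠ *ᶠ y) ψf≡ψe ⟩
          ψ e M +ᶠ -1ᶠ *ᶠ ψ e M           ≡⟨ x+-1*x≡0 (ψ e M) ⟩
          0ᶠ                              ∎
        z′≡z : coord z′ M ≡ coord z M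
        z′≡z = begin
          coord z′ M                      ≡⟨ 𝔽.+-identityʳ (coord z′ M) ⟨
          coord z′ M +ᶠ 0ᶠ                ≡⟨ cong (coord z′ M +ᶠ_) ψ[e-f]≡0 ⟨
          coord z′ M +ᶠ ψ (e ⊝ f) M       ≡⟨ coord-z′+ M ⟩
          coord z M                       ∎

    -- Two partial multisets of units of e have the same value of ψ at M. Removing the units between
    -- them yields an f that violates `exchange`.
    below⇒digitSum< : ∀ a → Agree a → ∀ {M} → coord (w a) M Fin.< ψ (digits a) M →
                      (∀ i → M < i → coord (w a) i ≡ ψ (digits a) i) → ¬ p ≤ digitSum {p} a
    below⇒digitSum< a agree {M} lt above p≤sum =
      exchange agree (f (toℕ i) (toℕ j)) (f≤e i<j) (f≺e i<j (s≤s⁻¹ (Fin.toℕ<n j))) lt above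
        (ψf≡ψe i<j ψi≡ψj)
      where
      e = digits a

      digitℕ : ℕ → ℕ
      digitℕ i = toℕ (at e i)

      toℕ-units : ∀ m i → toℕ (ι (takeUnits m digitℕ i)) ≡ takeUnits m digitℕ i
      toℕ-units m i = toℕ-ι-< (≤-<-trans (takeUnits-≤ m digitℕ i) (Fin.toℕ<n (at e i)))

      units : ℕ → FinSeq p
      units m = record
        { at     = λ i → ι (takeUnits m digitℕ i)
        ; bound  = a
        ; vanish = λ i a≤i → cong ι (n≤0⇒n≡0 (subst (takeUnits m digitℕ i ≤_)
                     (trans (cong toℕ (vanish e i a≤i)) toℕ-0ᶠ) (takeUnits-≤ m digitℕ i)))
        }

      -- The p + 1 lengths 0 to p compete for p values; a digit sum of at least p ensures that so
      -- many units exist.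
      collision = Fin.pigeonhole (n<1+n p) (λ (i : Fin (suc p)) → ψ (units (toℕ i)) M)
      i = proj₁ collision
      j = proj₁ (proj₂ collision)
      i<j = proj₁ (proj₂ (proj₂ collision))
      ψi≡ψj = proj₂ (proj₂ (proj₂ collision))

      -- e without its units number m + 1 to m′.
      f : ℕ → ℕ → FinSeq p
      f m m′ = (e ⊝ units m′) ⊕ units m

      units-mono : ∀ {m m′} → m < m′ → ∀ i → toℕ (at (units m) i) ≤ toℕ (at (units m′) i)
      units-mono {m} {m′} m<m′ i = subst₂ _≤_
        (sym (toℕ-units m i)) (sym (toℕ-units m′ i)) (takeUnits-mono digitℕ (<⇒≤ m<m′) i)

      units≤e : ∀ m i → toℕ (at (units m) i) ≤ digitℕ i
      units≤e m i = subst (_≤ digitℕ i) (sym (toℕ-units m i)) (takeUnits-≤ m digitℕ i)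

      f≤e : ∀ {m m′} → m < m′ → ∀ i → toℕ (at (f m m′) i) ≤ digitℕ i
      f≤e {m} {m′} m<m′ i = subst₂ _≤_
        (sym (toℕ-shift (at e i) (at (units m′) i) (at (units m) i) (units-mono m<m′ i) (units≤e m′ i)))
        (m∸n+n≡m (units≤e m′ i))
        (+-monoʳ-≤ (digitℕ i ∸ toℕ (at (units m′) i)) (units-mono m<m′ i))

      -- Equality would mean that nothing was removed, so the units would run out after m, although
      -- at least p of them exist and m < p.
      f≉e : ∀ {m m′} → m < m′ → m′ ≤ p → ¬ f m m′ ≈ e
      f≉e {m} {m′} m<m′ m′≤p f≈e = <-irrefl refl (begin-strict
        digitSum {p} a            ≡⟨ cong sum (map-upTo digitℕ a) ⟩
        sum (applyUpTo digitℕ a)  ≤⟨ takeUnits-saturates digitℕ m<m′ same a ⟩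
        m                         <⟨ m<m′ ⟩
        m′                        ≤⟨ m′≤p ⟩
        p                         ≤⟨ p≤sum ⟩
        digitSum {p} a            ∎)
        where
        open ≤-Reasoning
        same : ∀ i → takeUnits m digitℕ i ≡ takeUnits m′ digitℕ i
        same i = trans (sym (toℕ-units m i)) (trans (cong toℕ (+ᶠ-cancelˡ (at (e ⊝ units m′) i) _ _
          (trans (f≈e i) (sym (⊝-⊕-cancel e (units m′) i))))) (toℕ-units m′ i))

      f≺e : ∀ {m m′} → m < m′ → m′ ≤ p → at (f m m′) ≺ at e
      f≺e {m} {m′} m<m′ m′≤p = fromOrder (≺-compare (f m m′) e)
        where
        fromOrder : Order (at (f m m′)) (at e) → at (f m m′) ≺ at e
        fromOrder (less f≺e)              = f≺e
        fromOrder (equal f≈e)             = contradiction f≈e (f≉e m<m′ m′≤p)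
        fromOrder (greater (N , e<f , _)) = contradiction (f≤e m<m′ N) (<⇒≱ e<f)

      ψf≡ψe : ∀ {m m′} → m < m′ → ψ (units m) M ≡ ψ (units m′) M → ψ (f m m′) M ≡ ψ e M
      ψf≡ψe {m} {m′} m<m′ eq = begin
        ψ (f m m′) M                              ≡⟨ resp-⊕ (ψ-lin M) (e ⊝ units m′) (units m) ⟩
        ψ (e ⊝ units m′) M +ᶠ ψ (units m) M       ≡⟨ cong (ψ (e ⊝ units m′) M +ᶠ_) eq ⟩
        ψ (e ⊝ units m′) M +ᶠ ψ (units m′) M      ≡⟨ resp-⊕ (ψ-lin M) (e ⊝ units m′) (units m′) ⟨
        ψ ((e ⊝ units m′) ⊕ units m′) M
          ≡⟨ resp-≈ (ψ-lin M) {(e ⊝ units m′) ⊕ units m′} {e} (⊝-⊕-cancel e (units m′)) ⟩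
        ψ e M                                     ∎
        where open ≡-Reasoning

    w≈φ-large : ∀ a → Agree a → p ≤ digitSum {p} a → w a ≈ φ (digits a)
    w≈φ-large a agree p≤sum =
      [ id
      , (λ { (M , lt , above) → contradiction p≤sum (below⇒digitSum< a agree lt above) })
      ]′ (w≼φ a agree)

    agreeBelow : ∀ n → (∀ a → a < n → Agree a → w a ≈ φ (digits a)) → Agree n
    agreeBelow n step a a<n = <-rec (λ a → a < n → w a ≈ φ (digits a))
      (λ a rec a<n → step a a<n (λ b b<a → rec b<a (<-trans b<a a<n))) a a<n

    -- The hypothesis covers digit sums up to p - 1, and `w≈φ-large` covers the others.
    smallDigitSums⇒agree : ∀ n → (∀ a → a < n → digitSum {p} a ≤ p ∸ 1 → w a ≈ φ (digits a)) → Agree n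
    smallDigitSums⇒agree n small = agreeBelow n λ a a<n agree → case digitSum {p} a <? p of λ where
      (yes lt) → small a a<n (<⇒≤pred lt)
      (no ≮)  → w≈φ-large a agree (≮⇒≥ ≮)

    -- From (2) to (1): linearity of φ.

    agree⇒subspace : ∀ k → Agree (p ^ k) → IsSubspace (Lex w k)
    agree⇒subspace k agree = record
      { 0∈       = 0 , m^n>0 p k , ≈-sym {w 0} {0ˢ} w-zero
      ; ⊕-closed = λ { {x} {y} (a , a< , x≈wa) (b , b< , y≈wb) → inLex
          (digits a ⊕ digits b)
          (λ i k≤i → trans (cong₂ _+ᶠ_ (digit-< k a< k≤i) (digit-< k b< k≤i)) (𝔽.+-identityˡ 0ᶠ))
          (x ⊕ y)
          (λ i → trans (cong₂ _+ᶠ_ (trans (x≈wa i) (agree a a< i)) (trans (y≈wb i) (agree b b< i)))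
                       (sym (resp-⊕ (φ-lin i) (digits a) (digits b)))) }
      ; ⊙-closed = λ { c {x} (a , a< , x≈wa) → inLex
          (c ⊙ digits a)
          (λ i k≤i → trans (cong (c *ᶠ_) (digit-< k a< k≤i)) (𝔽.zeroʳ c))
          (c ⊙ x)
          (λ i → trans (cong (c *ᶠ_) (trans (x≈wa i) (agree a a< i)))
                       (sym (resp-⊙ (φ-lin i) c (digits a)))) }
      }
      where
      -- Digit vectors supported below k are the expansions of the numbers below p ^ k.
      inLex : ∀ e → VanishesFrom k e → ∀ x → x ≈ φ e → x ∈ Lex w k
      inLex e e≡0 x x≈φe with (a , a<p^k , a≈e) ← fromDigits k (at e) e≡0 =
        a , a<p^k , λ i → trans (x≈φe i) (sym (w≈φ {e = e} agree a<p^k a≈e i))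

    -- From (1) to (2): consequences of linearity of the code.

    module _ {k : ℕ} (sub : IsSubspace (Lex w k)) where
      open IsSubspace sub

      Lex-resp-≈ : ∀ {x y} → x ≈ y → y ∈ Lex w k → x ∈ Lex w k
      Lex-resp-≈ x≈y (a , a< , y≈wa) = a , a< , λ i → trans (x≈y i) (y≈wa i)

      p^∈Lex : ∀ {i} → i < k → w (p ^ i) ∈ Lex w k
      p^∈Lex {i} i<k = p ^ i , ^-monoʳ-< p (nonTrivial⇒n>1 p) i<k , λ _ → refl

      φ∈Lex : ∀ e → VanishesFrom k e → φ e ∈ Lex w k
      -- `bound e` may exceed k; the sum is first cut at k, so that every `w (p ^ i)` in it lies in
      -- the code.
      φ∈Lex e e≡0 = Lex-resp-≈ {φ e} {sumˢ k terms} (lin≈sumˢ (λ i → w (p ^ i)) e k e≡0) (partial k ≤-refl)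
        where
        terms : ℕ → FinSeq p
        terms i = at e i ⊙ w (p ^ i)
        partial : ∀ n → n ≤ k → sumˢ n terms ∈ Lex w k
        partial zero    _   = 0∈
        partial (suc n) n<k = ⊕-closed {sumˢ n terms} {terms n}
          (partial n (<⇒≤ n<k)) (⊙-closed (at e n) {w (p ^ n)} (p^∈Lex n<k))

      -- The word v = w(p^j) and its leading coordinate.

      module TopDigit {a : ℕ} (agree : Agree a) {j : ℕ} (j<k : j < k) (p^j≤a : p ^ j ≤ a) where

        u : FinSeq p
        u = unit j

        v≈φu : w (p ^ j) ≈ φ u
        v≈φu = φ-unit j

        -- Elements of the code are words, and the order of words reflects the order of their
        -- indices.
        below : ∀ x → x ∈ Lex w k → coord x ≺ ψ u → ∃[ m ] m < p ^ j × x ≈ w m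
        below x (m , _ , x≈wm) (N , lt , above) = m , w-reflects-<
          ( N
          , subst₂ Fin._<_ (coord-cong {x} {w m} x≈wm N) (sym (coord-cong {w (p ^ j)} {φ u} v≈φu N)) lt
          , λ i N<i → trans (sym (coord-cong {x} {w m} x≈wm i))
              (trans (above i N<i) (sym (coord-cong {w (p ^ j)} {φ u} v≈φu i)))
          ) , x≈wm

        -- A smaller `φ h`, being in the linear code, would be a word of index m < p ^ j and hence
        -- `φ (digits m)`. But h and `digits m` differ at j, so `φ-separated` keeps the two apart.
        ψ-minimal : ∀ h → VanishesFrom (suc j) h → at h j ≢ 0ᶠ → ¬ ψ h ≺ ψ u
        ψ-minimal h h≡0 hj≢0 ψh≺ψu =
          ¬d≤dist {φ h} {φ (digits m)} (λ i → trans (φh≈wm i) (agree m (<-≤-trans m<p^j p^j≤a) i))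
            (φ-separated agree h (digits m) j
              (λ eq → hj≢0 (trans eq (digit-< j m<p^j ≤-refl)))
              (λ i j<i → trans (h≡0 i j<i) (sym (digit-< j m<p^j (<⇒≤ j<i))))
              p^j≤a)
          where
          found = below (φ h) (φ∈Lex h (λ i k≤i → h≡0 i (≤-trans j<k k≤i))) ψh≺ψu
          m = proj₁ found
          m<p^j = proj₁ (proj₂ found)
          φh≈wm = proj₂ (proj₂ found)

        v-positive : Less F (w 0) (w (p ^ j))
        v-positive = w-mono (m^n>0 p j)

        -- As `w 0` is zero, the top difference from it is the leading position of v.
        N : ℕ
        N = proj₁ v-positive

        coord-w0 : ∀ i → coord (w 0) i ≡ 0ᶠ
        coord-w0 i = trans (coord-cong {w 0} {0ˢ} w-zero i) (resp-0 (coord-lin i))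

        ψu-above : ∀ i → N < i → ψ u i ≡ 0ᶠ
        ψu-above i N<i = trans (sym (coord-cong {w (p ^ j)} {φ u} v≈φu i))
          (trans (sym (proj₂ (proj₂ v-positive) i N<i)) (coord-w0 i))

        0<ψu : 0 < toℕ (ψ u N)
        0<ψu = ≤-<-trans z≤n (subst (coord (w 0) N Fin.<_)
          (coord-cong {w (p ^ j)} {φ u} v≈φu N) (proj₁ (proj₂ v-positive)))

        -- A leading entry above 1 could be scaled down to 1, giving a smaller vector whose digit
        -- vector still has top position j.
        ψu-lead : ψ u N ≡ 1ᶠ
        ψu-lead = Fin.toℕ-injective (trans (≤-antisym (≮⇒≥ ≮) 0<ψu) (sym toℕ-1ᶠ))
          where
          inverse = *ᶠ-inverse p-prime (ψ u N) (λ eq → <⇒≢ 0<ψu (sym (trans (cong toℕ eq) toℕ-0ᶠ)))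
          c = proj₁ inverse
          c*ψu≡1 = proj₂ inverse
          c≢0 : c ≢ 0ᶠ
          c≢0 c≡0 = 1≢0 (trans (sym c*ψu≡1) (trans (cong (_*ᶠ ψ u N) c≡0) (𝔽.zeroˡ (ψ u N))))
          ≮ : ¬ 1 < toℕ (ψ u N)
          ≮ 1<ψu = ψ-minimal (c ⊙ u)
            (λ i j<i → trans (cong (c *ᶠ_) (vanish u i j<i)) (𝔽.zeroʳ c))
            (λ eq → c≢0 (trans (sym (trans (cong (c *ᶠ_) (δ-diag j)) (𝔽.*-identityʳ c))) eq))
            ( N
            , subst (_< toℕ (ψ u N))
                (sym (trans (cong toℕ (trans (resp-⊙ (ψ-lin N) c u) c*ψu≡1)) toℕ-1ᶠ)) 1<ψu
            , λ i N<i → trans (resp-⊙ (ψ-lin i) c u)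
                (trans (cong (c *ᶠ_) (ψu-above i N<i)) (trans (𝔽.zeroʳ c) (sym (ψu-above i N<i))))
            )

        -- Otherwise subtracting a multiple of h from u would clear the entry of ψ u at M.
        ψu-reduced : ∀ h → VanishesFrom j h → ∀ M → ψ h M ≢ 0ᶠ → (∀ i → M < i → ψ h i ≡ 0ᶠ) → ψ u M ≡ 0ᶠ
        ψu-reduced h h≡0 M ψh≢0 above with ψ u M Fin.≟ 0ᶠ
        ... | yes eq = eq
        ... | no ψu≢0 = contradiction ψg≺ψu (ψ-minimal g g-above g-top)
          where
          open ≡-Reasoning
          inverse = *ᶠ-inverse p-prime (ψ h M) ψh≢0
          c = ψ u M *ᶠ proj₁ inverse
          g = u ⊝ c ⊙ h
          g-above : VanishesFrom (suc j) g
          g-above i j<i = trans (x-c*0≡x (δ j i) c (h≡0 i (<⇒≤ j<i))) (vanish u i j<i)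
          g-top : at g j ≢ 0ᶠ
          g-top eq = 1≢0 (trans (sym (trans (x-c*0≡x (δ j j) c (h≡0 j ≤-refl)) (δ-diag j))) eq)
          ψg : ∀ i → ψ g i ≡ ψ u i +ᶠ -1ᶠ *ᶠ (c *ᶠ ψ h i)
          ψg i = trans (resp-⊝ (ψ-lin i) u (c ⊙ h)) (cong (λ y → ψ u i +ᶠ -1ᶠ *ᶠ y) (resp-⊙ (ψ-lin i) c h))
          ψg≡0 : ψ g M ≡ 0ᶠ
          ψg≡0 = begin
            ψ g M
              ≡⟨ ψg M ⟩
            ψ u M +ᶠ -1ᶠ *ᶠ (c *ᶠ ψ h M)
              ≡⟨ cong (λ y → ψ u M +ᶠ -1ᶠ *ᶠ y) (*ᶠ-assoc (ψ u M) (proj₁ inverse) (ψ h M)) ⟩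
            ψ u M +ᶠ -1ᶠ *ᶠ (ψ u M *ᶠ (proj₁ inverse *ᶠ ψ h M))
              ≡⟨ cong (λ y → ψ u M +ᶠ -1ᶠ *ᶠ (ψ u M *ᶠ y)) (proj₂ inverse) ⟩
            ψ u M +ᶠ -1ᶠ *ᶠ (ψ u M *ᶠ 1ᶠ)
              ≡⟨ cong (λ y → ψ u M +ᶠ -1ᶠ *ᶠ y) (𝔽.*-identityʳ (ψ u M)) ⟩
            ψ u M +ᶠ -1ᶠ *ᶠ ψ u M
              ≡⟨ x+-1*x≡0 (ψ u M) ⟩
            0ᶠ ∎
          ψg≺ψu : ψ g ≺ ψ u
          ψg≺ψu = M , subst (_< toℕ (ψ u M)) (sym (trans (cong toℕ ψg≡0) toℕ-0ᶠ)) (≢0⇒0< ψu≢0) ,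
            λ i M<i → trans (ψg i) (x-c*0≡x (ψ u i) c (above i M<i))

        -- `φ h` is a word below v, so it vanishes above N. A nonzero entry at N would be its
        -- leading one, and `ψu-reduced` would clear the leading 1 of v.
        ψ-low : ∀ h → VanishesFrom j h → ∀ i → N ≤ i → ψ h i ≡ 0ᶠ
        ψ-low h h≡0 i N≤i = [ ψh-above i , (λ { refl → ψh-at }) ]′ (m≤n⇒m<n∨m≡n N≤i)
          where
          found = fromDigits j (at h) h≡0
          b = proj₁ found
          b<p^j = proj₁ (proj₂ found)
          wb≈φh : w b ≈ φ h
          wb≈φh = w≈φ {e = h} agree (<-≤-trans b<p^j p^j≤a) (proj₂ (proj₂ found))
          h≺u : Less F (w b) (w (p ^ j))
          h≺u = w-mono b<p^j
          N′ = proj₁ h≺u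
          N′≤N : N′ ≤ N
          N′≤N = ≮⇒≥ λ N<N′ → ≮0 {coord (w b) N′} {coord (w (p ^ j)) N′}
            (trans (coord-cong {w (p ^ j)} {φ u} v≈φu N′) (ψu-above N′ N<N′)) (proj₁ (proj₂ h≺u))
          ψh-above : ∀ i → N < i → ψ h i ≡ 0ᶠ
          ψh-above i N<i = trans (sym (coord-cong {w b} {φ h} wb≈φh i))
            (trans (proj₂ (proj₂ h≺u) i (≤-<-trans N′≤N N<i))
              (trans (coord-cong {w (p ^ j)} {φ u} v≈φu i) (ψu-above i N<i)))
          ψh-at : ψ h N ≡ 0ᶠ
          ψh-at = decidable-stable (ψ h N Fin.≟ 0ᶠ) λ ψh≢0 →
            1≢0 (trans (sym ψu-lead) (ψu-reduced h h≡0 N ψh≢0 ψh-above))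

        -- Excluding w(a) below w⁺(a) in a linear code.

        module _ (top≢0 : digit a j ≢ 0ᶠ) (digits-above : VanishesFrom (suc j) (digits a))
                 (wa∈Lex : w a ∈ Lex w k) {M : ℕ} (lt : coord (w a) M Fin.< ψ (digits a) M)
                 (above : ∀ i → M < i → coord (w a) i ≡ ψ (digits a) i) where
          open ≡-Reasoning

          private
            e = digits a
            c = digit a j
            s = coord (w a) N
            -- Parallel splittings e = r + c u and `w a` = y + s v: r is supported below j, and s is
            -- chosen so that y vanishes at N.
            r = e ⊝ c ⊙ u
            y = w a ⊝ s ⊙ w (p ^ j)

            r≡0 : VanishesFrom j r
            r≡0 i j≤i =
              [ (λ j<i → trans (x-c*0≡x (at e i) c (vanish u i j<i)) (digits-above i j<i))
              , (λ { refl → trans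
                  (cong (λ x → c +ᶠ -1ᶠ *ᶠ x) (trans (cong (c *ᶠ_) (δ-diag j)) (𝔽.*-identityʳ c)))
                  (x+-1*x≡0 c) })
              ]′ (m≤n⇒m<n∨m≡n j≤i)

            ψe : ∀ i → ψ e i ≡ ψ r i +ᶠ c *ᶠ ψ u i
            ψe i = begin
              ψ e i                        ≡⟨ resp-≈ (ψ-lin i) {r ⊕ c ⊙ u} {e} (⊝-⊕-cancel e (c ⊙ u)) ⟨
              ψ (r ⊕ c ⊙ u) i              ≡⟨ resp-⊕ (ψ-lin i) r (c ⊙ u) ⟩
              ψ r i +ᶠ ψ (c ⊙ u) i         ≡⟨ cong (ψ r i +ᶠ_) (resp-⊙ (ψ-lin i) c u) ⟩
              ψ r i +ᶠ c *ᶠ ψ u i          ∎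

            ψe-above : ∀ i → N < i → ψ e i ≡ 0ᶠ
            ψe-above i N<i = begin
              ψ e i                        ≡⟨ ψe i ⟩
              ψ r i +ᶠ c *ᶠ ψ u i          ≡⟨ cong₂ (λ x y → x +ᶠ c *ᶠ y)
                                                (ψ-low r r≡0 i (<⇒≤ N<i)) (ψu-above i N<i) ⟩
              0ᶠ +ᶠ c *ᶠ 0ᶠ                ≡⟨ 𝔽.+-identityˡ (c *ᶠ 0ᶠ) ⟩
              c *ᶠ 0ᶠ                      ≡⟨ 𝔽.zeroʳ c ⟩
              0ᶠ                           ∎

            ψe-lead : ψ e N ≡ c
            ψe-lead = begin
              ψ e N                        ≡⟨ ψe N ⟩
              ψ r N +ᶠ c *ᶠ ψ u N          ≡⟨ cong₂ (λ x y → x +ᶠ c *ᶠ y) (ψ-low r r≡0 N ≤-refl) ψu-lead ⟩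
              0ᶠ +ᶠ c *ᶠ 1ᶠ                ≡⟨ 𝔽.+-identityˡ (c *ᶠ 1ᶠ) ⟩
              c *ᶠ 1ᶠ                      ≡⟨ 𝔽.*-identityʳ c ⟩
              c                            ∎

            M≤N : M ≤ N
            M≤N = ≮⇒≥ λ N<M → ≮0 {coord (w a) M} {ψ e M} (ψe-above M N<M) lt

            wa-above : ∀ i → N < i → coord (w a) i ≡ 0ᶠ
            wa-above i N<i = trans (above i (≤-<-trans M≤N N<i)) (ψe-above i N<i)

            -- `ψ e` has entry c at N; `w a` has the same entry there if M < N and a smaller one if
            -- M = N.
            s≤c : toℕ s ≤ toℕ c
            s≤c = [ (λ M<N → ≤-reflexive (cong toℕ (trans (above N M<N) ψe-lead)))
                  , (λ M≡N → <⇒≤ (subst (toℕ s <_) (cong toℕ ψe-lead)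
                      (subst (λ i → coord (w a) i Fin.< ψ e i) M≡N lt)))
                  ]′ (m≤n⇒m<n∨m≡n M≤N)

            coord-y : ∀ i → coord y i ≡ coord (w a) i +ᶠ -1ᶠ *ᶠ (s *ᶠ ψ u i)
            coord-y i = begin
              coord y i
                ≡⟨ resp-⊝ (coord-lin i) (w a) (s ⊙ w (p ^ j)) ⟩
              coord (w a) i +ᶠ -1ᶠ *ᶠ coord (s ⊙ w (p ^ j)) i
                ≡⟨ cong (λ x → coord (w a) i +ᶠ -1ᶠ *ᶠ x) (resp-⊙ (coord-lin i) s (w (p ^ j))) ⟩
              coord (w a) i +ᶠ -1ᶠ *ᶠ (s *ᶠ coord (w (p ^ j)) i)
                ≡⟨ cong (λ x → coord (w a) i +ᶠ -1ᶠ *ᶠ (s *ᶠ x)) (coord-cong {w (p ^ j)} {φ u} v≈φu i) ⟩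
              coord (w a) i +ᶠ -1ᶠ *ᶠ (s *ᶠ ψ u i) ∎

            y-at : coord y N ≡ 0ᶠ
            y-at = begin
              coord y N                        ≡⟨ coord-y N ⟩
              s +ᶠ -1ᶠ *ᶠ (s *ᶠ ψ u N)         ≡⟨ cong (λ x → s +ᶠ -1ᶠ *ᶠ (s *ᶠ x)) ψu-lead ⟩
              s +ᶠ -1ᶠ *ᶠ (s *ᶠ 1ᶠ)            ≡⟨ cong (λ x → s +ᶠ -1ᶠ *ᶠ x) (𝔽.*-identityʳ s) ⟩
              s +ᶠ -1ᶠ *ᶠ s                    ≡⟨ x+-1*x≡0 s ⟩
              0ᶠ                               ∎

            y≺u : coord y ≺ ψ u
            y≺u = N , subst (_< toℕ (ψ u N)) (sym (trans (cong toℕ y-at) toℕ-0ᶠ)) 0<ψu ,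
              λ i N<i → trans (coord-y i) (trans (x-c*0≡x (coord (w a) i) s (ψu-above i N<i))
                (trans (wa-above i N<i) (sym (ψu-above i N<i))))

            -- y vanishes from N on, so it is below v; linearity puts it in the code, hence it is a
            -- word of index m < p ^ j.
            found = below y
              (⊕-closed {w a} {(-1ᶠ) ⊙ (s ⊙ w (p ^ j))} wa∈Lex
                (⊙-closed -1ᶠ {s ⊙ w (p ^ j)} (⊙-closed s {w (p ^ j)} (p^∈Lex j<k)))) y≺u
            m = proj₁ found
            m<p^j = proj₁ (proj₂ found)
            y≈wm = proj₂ (proj₂ found)
            t = digits m
            h = t ⊕ s ⊙ u

            wm≈φt : w m ≈ φ t
            wm≈φt = agree m (<-≤-trans m<p^j p^j≤a)

            wa≈φh : w a ≈ φ h
            wa≈φh i = begin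
              at (w a) i                              ≡⟨ ⊝-⊕-cancel (w a) (s ⊙ w (p ^ j)) i ⟨
              at y i +ᶠ s *ᶠ at (w (p ^ j)) i         ≡⟨ cong₂ (λ x y → x +ᶠ s *ᶠ y)
                                                           (trans (y≈wm i) (wm≈φt i)) (v≈φu i) ⟩
              at (φ t) i +ᶠ s *ᶠ at (φ u) i           ≡⟨ cong (at (φ t) i +ᶠ_) (resp-⊙ (φ-lin i) s u) ⟨
              at (φ t) i +ᶠ at (φ (s ⊙ u)) i          ≡⟨ resp-⊕ (φ-lin i) t (s ⊙ u) ⟨
              at (φ h) i                              ∎

            coord-wa : ∀ i → coord (w a) i ≡ ψ t i +ᶠ s *ᶠ ψ u i
            coord-wa i = trans (coord-cong {w a} {φ h} wa≈φh i)
              (trans (resp-⊕ (ψ-lin i) t (s ⊙ u)) (cong (ψ t i +ᶠ_) (resp-⊙ (ψ-lin i) s u)))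

            -- If h were smaller, its index would be below a and its word would repeat `w a`.
            h⊀e : ¬ at h ≺ at e
            h⊀e h≺e = w-distinct m′<a λ i →
              trans (wa≈φh i) (sym (w≈φ {e = h} agree m′<a (proj₂ (index h)) i))
              where
              m′<a : proj₁ (index h) < a
              m′<a = ≺-index h (proj₂ (index h)) h≺e

            t≡0 : VanishesFrom j t
            t≡0 i j≤i = digit-< j m<p^j j≤i

            -- The top digit of h is s, so s < c would make h smaller than e.
            s≡c : s ≡ c
            s≡c = [ (λ s<c → contradiction (h≺e s<c) h⊀e) , Fin.toℕ-injective ]′ (m≤n⇒m<n∨m≡n s≤c)
              where
              h-top : at h j ≡ s
              h-top = trans (cong₂ (λ x y → x +ᶠ s *ᶠ y) (t≡0 j ≤-refl) (δ-diag j))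
                (trans (𝔽.+-identityˡ (s *ᶠ 1ᶠ)) (𝔽.*-identityʳ s))
              h≺e : toℕ s < toℕ c → at h ≺ at e
              h≺e s<c = j , subst (_< toℕ c) (cong toℕ (sym h-top)) s<c , λ i j<i →
                trans (cong₂ (λ x y → x +ᶠ s *ᶠ y) (t≡0 i (<⇒≤ j<i)) (vanish u i j<i))
                  (trans (𝔽.+-identityˡ (s *ᶠ 0ᶠ)) (trans (𝔽.zeroʳ s) (sym (digits-above i j<i))))

            wa≡e⇒t≡r : ∀ i → coord (w a) i ≡ ψ e i → ψ t i ≡ ψ r i
            wa≡e⇒t≡r i eq = +ᶠ-cancelʳ (s *ᶠ ψ u i) (ψ t i) (ψ r i) (begin
              ψ t i +ᶠ s *ᶠ ψ u i         ≡⟨ coord-wa i ⟨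
              coord (w a) i               ≡⟨ eq ⟩
              ψ e i                       ≡⟨ ψe i ⟩
              ψ r i +ᶠ c *ᶠ ψ u i         ≡⟨ cong (λ x → ψ r i +ᶠ x *ᶠ ψ u i) s≡c ⟨
              ψ r i +ᶠ s *ᶠ ψ u i         ∎)

            t≡r⇒wa≡e : ∀ i → ψ t i ≡ ψ r i → coord (w a) i ≡ ψ e i
            t≡r⇒wa≡e i eq = begin
              coord (w a) i               ≡⟨ coord-wa i ⟩
              ψ t i +ᶠ s *ᶠ ψ u i         ≡⟨ cong₂ (λ x y → x +ᶠ y *ᶠ ψ u i) eq s≡c ⟩
              ψ r i +ᶠ c *ᶠ ψ u i         ≡⟨ ψe i ⟨
              ψ e i                       ∎

            -- With s = c, `w a` and `φ e` differ by `φ (t ⊝ r)`, whose leading position is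
            -- therefore M, and v is reduced there.
            ψu≡0 : ψ u M ≡ 0ᶠ
            ψu≡0 = ψu-reduced (t ⊝ r)
              (λ i j≤i → trans (cong₂ (λ x y → x +ᶠ -1ᶠ *ᶠ y) (t≡0 i j≤i) (r≡0 i j≤i)) (x+-1*x≡0 0ᶠ))
              M
              (λ eq → <⇒≢ lt (cong toℕ (t≡r⇒wa≡e M
                (x+-1*y≡0⇒x≡y (ψ t M) (ψ r M) (trans (sym (resp-⊝ (ψ-lin M) t r)) eq)))))
              (λ i M<i → trans (resp-⊝ (ψ-lin i) t r)
                (trans (cong (λ x → x +ᶠ -1ᶠ *ᶠ ψ r i) (wa≡e⇒t≡r i (above i M<i))) (x+-1*x≡0 (ψ r i))))

            x+c*ψu≡x : ∀ x c → x +ᶠ c *ᶠ ψ u M ≡ x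
            x+c*ψu≡x x c = trans (cong (x +ᶠ_) (trans (cong (c *ᶠ_) ψu≡0) (𝔽.zeroʳ c))) (𝔽.+-identityʳ x)

            r-word = fromDigits j (at r) r≡0
            m′ = proj₁ r-word
            m′<p^j = proj₁ (proj₂ r-word)
            m′≈r = proj₂ (proj₂ r-word)

            wm′≈φr : w m′ ≈ φ r
            wm′≈φr = w≈φ {e = r} agree (<-≤-trans m′<p^j p^j≤a) m′≈r

            -- Since v vanishes at M, removing c v from `w a` and `φ e` leaves the entries at M
            -- unchanged, and the comparison passes to `w m` and `w m′`.
            m<m′ : m < m′
            m<m′ = w-reflects-<
              ( M
              , subst₂ Fin._<_
                  (trans (coord-wa M) (trans (x+c*ψu≡x (ψ t M) s) (sym (coord-cong {w m} {φ t} wm≈φt M))))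
                  (trans (ψe M) (trans (x+c*ψu≡x (ψ r M) c) (sym (coord-cong {w m′} {φ r} wm′≈φr M))))
                  lt
              , λ i M<i → trans (coord-cong {w m} {φ t} wm≈φt i)
                  (trans (wa≡e⇒t≡r i (above i M<i)) (sym (coord-cong {w m′} {φ r} wm′≈φr i))) )

            -- t is smaller than r at a position q below j; adding c u affects position j alone.
            h≺e : at h ≺ at e
            h≺e = q , subst₂ Fin._<_ (sym hq≡tq) (sym eq≡rq) (subst (digit m q Fin.<_) (m′≈r q) t<r) ,
              λ i q<i → begin
                at t i +ᶠ s *ᶠ δ j i    ≡⟨ cong₂ (λ x y → x +ᶠ y *ᶠ δ j i) (trans (t≡r i q<i) (m′≈r i)) s≡c ⟩
                at r i +ᶠ c *ᶠ δ j i    ≡⟨ ⊝-⊕-cancel e (c ⊙ u) i ⟩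
                at e i                  ∎
              where
              q = proj₁ (digits-mono m<m′)
              t<r = proj₁ (proj₂ (digits-mono m<m′))
              t≡r = proj₂ (proj₂ (digits-mono m<m′))
              q<j : q < j
              q<j = ≰⇒> λ j≤q → ≮0 {digit m q} {digit m′ q} (digit-< j m′<p^j j≤q) t<r
              δ≡0 : δ j q ≡ 0ᶠ
              δ≡0 = δ-≢ j q (≢-sym (<⇒≢ q<j))
              hq≡tq : at h q ≡ at t q
              hq≡tq = trans (cong (λ x → at t q +ᶠ s *ᶠ x) δ≡0)
                (trans (cong (at t q +ᶠ_) (𝔽.zeroʳ s)) (𝔽.+-identityʳ (at t q)))
              eq≡rq : at e q ≡ at r q
              eq≡rq = sym (x-c*0≡x (at e q) c δ≡0)

          ¬wa<φe : ⊥
          ¬wa<φe = h⊀e h≺e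

      subspace⇒agree : Agree (p ^ k)
      subspace⇒agree = agreeBelow (p ^ k) step
        where
        step : ∀ a → a < p ^ k → Agree a → w a ≈ φ (digits a)
        step zero      _     _     = w-zero
        step a@(suc _) a<p^k agree =
          [ id
          , (λ { (M , lt , above) → ⊥-elim (TopDigit.¬wa<φe agree j<k (digit≢0⇒p^≤ a j top≢0)
                                              top≢0 digits-above (a , a<p^k , λ _ → refl) lt above) })
          ]′ (w≼φ a agree)
          where
          -- The top difference from the digits of 0 is the top nonzero digit of a.
          top : digit 0 ≺ digit a
          top = digits-mono z<s
          j = proj₁ top
          top≢0 : digit a j ≢ 0ᶠ
          top≢0 eq = ≮0 {digit 0 j} {digit a j} eq (proj₁ (proj₂ top))
          digits-above : VanishesFrom (suc j) (digits a)
          digits-above i j<i = trans (sym (proj₂ (proj₂ top) i j<i)) (digit-0 i)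
          j<k : j < k
          j<k = ≰⇒> λ k≤j → top≢0 (digit-< k a<p^k k≤j)

theorem1p4 : (p : ℕ) .{{_ : NonTrivial p}} → Prime p →
    (d : ℕ) → 2 ≤ d →
    (F : OrderedBasis p) (k : ℕ) →
    (w : ℕ → FinSeq p) → IsLexWords F d w →
    (IsSubspace (Lex w k) ⇔ (∀ a → a < p ^ k → w a ≈ (w ⁺) a))
    × ((∀ a → a < p ^ k → w a ≈ (w ⁺) a)
    ⇔ (∀ a → a < p ^ k → digitSum {p} a ≤ p ∸ 1 → w a ≈ (w ⁺) a))
theorem1p4 p p-prime d 2≤d F k w w-lex =
  mk⇔ (subspace⇒agree p-prime 2≤d F w w-lex {k}) (agree⇒subspace p-prime 2≤d F w w-lex k) ,
  mk⇔ (λ agree a a<p^k _ → agree a a<p^k) (smallDigitSums⇒agree p-prime 2≤d F w w-lex (p ^ k))
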